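{- Every GaTEx graph that contains no induced house is Meyniel, very strongly perfect and brittle.
   Context: All graphs are finite, simple and undirected. A galled-tree on a finite nonempty set $X$ is a directed acyclic graph $N=(V,E)$ such that either $V=X=\{x\}$ and $E=\emptyset$, or: (N1) there is a unique root with indegree 0 and outdegree at least 2; (N2) $x\in X$ iff $x$ has outdegree 0 and indegree 1; (N3) every non-root $v\in V\setminus X$ has either indegree 1 and outdegree at least 2, or indegree 2 and outdegree at least 1 (hybrid-vertex); (N4) each biconnected component $C$ of $N$ contains at most one hybrid-vertex whose two in-neighbours both belong to $C$. For $x,y\in X$, $\mathrm{lca}_N(x,y)$ is the (unique) minimal common ancestor of $x,y$. A labeled galled-tree $(N,t)$ has $t:V\to\{0,1,\odot\}$ with $t(x)=\odot$ iff $x\in X$; it explains the graph on $X$ where $\{x,y\}$ is an edge iff $t(\mathrm{lca}_N(x,y))=1$. A graph is GaTEx if it is isomorphic to a graph explained by some labeled galled-tree. The house is the complement of the path on five vertices. A graph is Meyniel if every odd cycle of length at least five has at least two chords. A graph is very strongly perfect if for every induced subgraph $H$, every vertex of $H$ belongs to a stable set of $H$ meeting all maximal cliques of $H$. A vertex $x$ of $G$ is soft if it is either not a midpoint of any induced $P_4$ of $G$ or not an endpoint of any induced $P_4$ of $G$; $G$ is brittle if every induced subgraph of $G$ has a soft vertex. -}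

module Defs where

open import Data.Nat using (ℕ; zero; suc; _+_; _*_; _≤_; _<_; _≡ᵇ_)
open import Data.Fin using (Fin; zero; suc; toℕ)
open import Data.Fin.Subset using (Subset; _∈_; _⊆_)
open import Data.Bool using (Bool; true; false; not; _∧_; _∨_; if_then_else_)
open import Data.Product using (Σ; ∃; ∃-syntax; _×_; _,_)
open import Data.Sum using (_⊎_)
open import Relation.Nullary using (¬_)
open import Relation.Binary.PropositionalEquality using (_≡_; _≢_)
open import Relation.Binary.Construct.Closure.ReflexiveTransitive using (Star)
open import Relation.Binary.Construct.Closure.Transitive using (TransClosure)
open import Function.Definitions using (Injective)
open import Function.Bundles using (_⇔_)

record Graph (n : ℕ) : Set where
  field
    adj        : Fin n → Fin n → Bool
    adj-sym    : ∀ x y → adj x y ≡ adj y x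
    adj-irrefl : ∀ x → adj x x ≡ false
open Graph public

Edge : ∀ {n} → Graph n → Fin n → Fin n → Set
Edge G x y = adj G x y ≡ true

pathAdj : ∀ {k} → Fin k → Fin k → Bool
pathAdj i j = (suc (toℕ i) ≡ᵇ toℕ j) ∨ (suc (toℕ j) ≡ᵇ toℕ i)

-- house = complement of P5
houseAdj : Fin 5 → Fin 5 → Bool
houseAdj i j = not (pathAdj i j) ∧ not (toℕ i ≡ᵇ toℕ j)

InducedCopyIn : ∀ {n k} → Graph n → Subset n → (Fin k → Fin k → Bool) → (Fin k → Fin n) → Set
InducedCopyIn G S pat f =
  Injective _≡_ _≡_ f × (∀ i → f i ∈ S) × (∀ i j → adj G (f i) (f j) ≡ pat i j)

InducedCopy : ∀ {n k} → Graph n → (Fin k → Fin k → Bool) → (Fin k → Fin n) → Set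
InducedCopy G pat f = Injective _≡_ _≡_ f × (∀ i j → adj G (f i) (f j) ≡ pat i j)

HasInducedHouse : ∀ {n} → Graph n → Set
HasInducedHouse G = ∃[ f ] InducedCopy G houseAdj f

CycNext : (k : ℕ) → Fin k → Fin k → Set
CycNext k i j = (suc (toℕ i) ≡ toℕ j) ⊎ ((suc (toℕ i) ≡ k) × (toℕ j ≡ 0))

IsCycle : ∀ {n} → Graph n → (k : ℕ) → (Fin k → Fin n) → Set
IsCycle G k c = Injective _≡_ _≡_ c × (∀ i j → CycNext k i j → Edge G (c i) (c j))

IsChord : ∀ {n} → Graph n → (k : ℕ) → (Fin k → Fin n) → Fin k → Fin k → Set
IsChord G k c i j =
  toℕ i < toℕ j × ¬ CycNext k i j × ¬ CycNext k j i × Edge G (c i) (c j)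

Meyniel : ∀ {n} → Graph n → Set
Meyniel G = ∀ (j : ℕ) (c : Fin (5 + 2 * j) → Fin _) → IsCycle G (5 + 2 * j) c →
  ∃[ a ] ∃[ b ] ∃[ a' ] ∃[ b' ]
    (IsChord G (5 + 2 * j) c a b × IsChord G (5 + 2 * j) c a' b' × ¬ ((a ≡ a') × (b ≡ b')))

-- Very strongly perfect graphs
-- induced subgraphs are given by their vertex sets S

StableIn : ∀ {n} → Graph n → Subset n → Subset n → Set
StableIn G S T = T ⊆ S × (∀ x y → x ∈ T → y ∈ T → ¬ Edge G x y)

CliqueIn : ∀ {n} → Graph n → Subset n → Subset n → Set
CliqueIn G S K = K ⊆ S × (∀ x y → x ∈ K → y ∈ K → x ≢ y → Edge G x y)

MaximalCliqueIn : ∀ {n} → Graph n → Subset n → Subset n → Set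
MaximalCliqueIn G S K = CliqueIn G S K × (∀ K' → CliqueIn G S K' → K ⊆ K' → K' ⊆ K)

VeryStronglyPerfect : ∀ {n} → Graph n → Set
VeryStronglyPerfect {n} G = ∀ (S : Subset n) (v : Fin n) → v ∈ S →
  ∃[ T ] (v ∈ T × StableIn G S T ×
          (∀ K → MaximalCliqueIn G S K → ∃[ u ] (u ∈ T × u ∈ K)))

MidpointP4 : ∀ {n} → Graph n → Subset n → Fin n → Set
MidpointP4 G S x = ∃[ f ] (InducedCopyIn G S (pathAdj {4}) f × ((f (suc zero) ≡ x) ⊎ (f (suc (suc zero)) ≡ x)))

EndpointP4 : ∀ {n} → Graph n → Subset n → Fin n → Set
EndpointP4 G S x = ∃[ f ] (InducedCopyIn G S (pathAdj {4}) f × ((f zero ≡ x) ⊎ (f (suc (suc (suc zero))) ≡ x)))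

Soft : ∀ {n} → Graph n → Subset n → Fin n → Set
Soft G S x = ¬ MidpointP4 G S x ⊎ ¬ EndpointP4 G S x

Brittle : ∀ {n} → Graph n → Set
Brittle {n} G = ∀ (S : Subset n) → (∃[ v ] v ∈ S) → ∃[ x ] (x ∈ S × Soft G S x)

Arc : ∀ {m} → (Fin m → Fin m → Bool) → Fin m → Fin m → Set
Arc A u v = A u v ≡ true

count : ∀ {m} → (Fin m → Bool) → ℕ
count {zero} p = 0
count {suc m} p = (if p zero then 1 else 0) + count (λ i → p (suc i))

indeg : ∀ {m} → (Fin m → Fin m → Bool) → Fin m → ℕ
indeg A v = count (λ u → A u v)

outdeg : ∀ {m} → (Fin m → Fin m → Bool) → Fin m → ℕ
outdeg A v = count (λ w → A v w)

Acyclic : ∀ {m} → (Fin m → Fin m → Bool) → Set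
Acyclic A = ∀ v → ¬ TransClosure (Arc A) v v

Ancestor : ∀ {m} → (Fin m → Fin m → Bool) → Fin m → Fin m → Set
Ancestor A = Star (Arc A)

-- leaf set X = image of the leaf embedding ℓ
InX : ∀ {n m} → (Fin n → Fin m) → Fin m → Set
InX ℓ v = ∃[ x ] ℓ x ≡ v

UAdjIn : ∀ {m} → (Fin m → Fin m → Bool) → Subset m → Fin m → Fin m → Set
UAdjIn A S u v = u ∈ S × v ∈ S × (Arc A u v ⊎ Arc A v u)

UAdjAvoid : ∀ {m} → (Fin m → Fin m → Bool) → Subset m → Fin m → Fin m → Fin m → Set
UAdjAvoid A S w u v = u ≢ w × v ≢ w × UAdjIn A S u v

Biconnected : ∀ {m} → (Fin m → Fin m → Bool) → Subset m → Set
Biconnected A S =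
  (∃[ u ] ∃[ v ] (u ≢ v × u ∈ S × v ∈ S)) ×
  (∀ u v → u ∈ S → v ∈ S → Star (UAdjIn A S) u v) ×
  (∀ w → w ∈ S → ∀ u v → u ∈ S → v ∈ S → u ≢ w → v ≢ w → Star (UAdjAvoid A S w) u v)

BiconnectedComponent : ∀ {m} → (Fin m → Fin m → Bool) → Subset m → Set
BiconnectedComponent A C = Biconnected A C × (∀ C' → C ⊆ C' → Biconnected A C' → C' ⊆ C)

HybridWithParentsIn : ∀ {m} → (Fin m → Fin m → Bool) → Subset m → Fin m → Set
HybridWithParentsIn A C v = indeg A v ≡ 2 × (∀ u → Arc A u v → u ∈ C)

TrivialGalledTree : ∀ {n m} → (Fin m → Fin m → Bool) → (Fin n → Fin m) → Set
TrivialGalledTree {n} A ℓ = n ≡ 1 × (∀ v → InX ℓ v) × (∀ u v → A u v ≡ false)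

record NonTrivialGalledTree {n m} (A : Fin m → Fin m → Bool) (ℓ : Fin n → Fin m) : Set where
  field
    root        : Fin m
    root-indeg  : indeg A root ≡ 0
    root-outdeg : 2 ≤ outdeg A root
    root-unique : ∀ v → indeg A v ≡ 0 → v ≡ root
    leaves      : ∀ v → InX ℓ v ⇔ (outdeg A v ≡ 0 × indeg A v ≡ 1)
    inner       : ∀ v → v ≢ root → ¬ InX ℓ v →
                    (indeg A v ≡ 1 × 2 ≤ outdeg A v) ⊎ (indeg A v ≡ 2 × 1 ≤ outdeg A v)
    galled      : ∀ C → BiconnectedComponent A C →
                    ∀ v w → HybridWithParentsIn A C v → HybridWithParentsIn A C w → v ≡ w

IsGalledTree : ∀ {n m} → (Fin m → Fin m → Bool) → (Fin n → Fin m) → Set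
IsGalledTree A ℓ = Acyclic A × (TrivialGalledTree A ℓ ⊎ NonTrivialGalledTree A ℓ)

data Label : Set where
  lab0 lab1 odot : Label

IsLCA : ∀ {m} → (Fin m → Fin m → Bool) → Fin m → Fin m → Fin m → Set
IsLCA A u a b =
  (Ancestor A u a × Ancestor A u b) ×
  (∀ w → Ancestor A w a → Ancestor A w b → Ancestor A u w → w ≡ u)

-- G is GaTEx: G is explained by a labeled galled-tree (N , t) whose leaf set X is
-- identified with the vertex set of G via the injective map ℓ (this bijection
-- Fin n ≅ X is the isomorphism of G with the explained graph)
record GaTExWitness {n} (G : Graph n) : Set where
  field
    m         : ℕ
    A         : Fin m → Fin m → Bool
    ℓ         : Fin n → Fin m
    t         : Fin m → Label
    X-nonempty : 1 ≤ n
    ℓ-inj     : Injective _≡_ _≡_ ℓ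
    galledTree : IsGalledTree A ℓ
    t-odot    : ∀ v → (t v ≡ odot) ⇔ InX ℓ v
    explains  : ∀ x y → x ≢ y → Edge G x y ⇔ (∃[ u ] (IsLCA A u (ℓ x) (ℓ y) × t u ≡ lab1))

IsGaTEx : ∀ {n} → Graph n → Set
IsGaTEx G = GaTExWitness G

{-# OPTIONS --safe #-}
module Submission where

-- All three properties follow from an elimination property: every induced subgraph with at least two
-- vertices has two vertices that are not midpoints of a P4. Deleting non-midpoints other than v one at
-- a time yields a stable set through v meeting all maximal cliques; and on a cycle of length at least
-- five with fewer than two chords, at most one vertex is not a midpoint.
--
-- Elimination passes from a module and its quotient to the whole graph, so only prime induced
-- subgraphs matter. Call p ⟶ h an entry of w if h lies strictly below w but p does not lie below w.
-- An entry of w closes a cycle through the arc above w, and two biconnected sets sharing an arc have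
-- a biconnected union; hence, by (N4), w has at most one entry, and none if w is a hybrid-vertex. A
-- vertex without entries has a module of leaves below it. A prime set of leaves therefore lives on a
-- single gall: it consists of two P4-free parts with at most one vertex in common (below the hybrid),
-- all other pairs across being uniformly adjacent or non-adjacent. There elimination is read off
-- directly, house-freeness being needed only in the adjacent case.

open import Defs
open import Data.Bool using (Bool; true; false; not)
import Data.Bool as Bool
open import Data.Bool.Properties using (not-involutive; not-¬; ¬-not)
open import Data.Empty using (⊥; ⊥-elim)
open import Data.Fin using (Fin; zero; suc; _≟_; toℕ; fromℕ; inject₁)
open import Data.Fin.Induction using (spo-wellFounded; spo-noetherian)
open import Data.Fin.Properties using (any?; all?; <-cmp; toℕ-fromℕ; toℕ-inject₁; toℕ-injective; inject₁-injective; fromℕ≢inject₁)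
open import Data.Fin.Relation.Unary.Top using (view; ‵fromℕ; ‵inject₁)
open import Data.Fin.Subset as Subset using (Subset; _∈_; _∉_; _⊆_; _⊂_; _⊃_; _∪_)
open import Data.Fin.Subset.Induction using (⊂-wellFounded; ⊃-wellFounded; Acc; acc)
open import Data.Fin.Subset.Properties using (_∈?_; _⊆?_; anySubset?; x∈p∪q⁻; x∈p∪q⁺; ∉⊥)
open import Data.List using (List; []; _∷_)
import Data.List.Membership.DecPropositional as ListMembership
open import Data.List.Relation.Unary.Any using (here; there)
open import Data.Nat using (ℕ; zero; suc; _+_; _≤_; s≤s; z≤n)
import Data.Nat.Properties as ℕ
open import Data.Product using (∃-syntax; _×_; _,_; proj₁; proj₂)
open import Data.Sum using (_⊎_; inj₁; inj₂; swap)
open import Data.Vec using (tabulate)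
open import Data.Vec.Properties using (lookup⇒[]=; []=⇒lookup; lookup∘tabulate)
open import Function using (_∘_; case_of_; flip; id)
open import Function.Bundles using (Equivalence; _⇔_)
open import Relation.Binary.Construct.Closure.ReflexiveTransitive using (Star; ε; _◅_; _◅◅_; reverse; gmap)
open import Relation.Binary.Construct.Closure.Transitive using (TransClosure; [_]; _∷_)
import Relation.Binary.Construct.Closure.Transitive as Plus
open import Relation.Binary.Definitions using (tri<; tri≈; tri>)
open import Relation.Binary.PropositionalEquality
open import Relation.Binary.Structures using (IsStrictPartialOrder)
open import Relation.Nullary using (¬_; Dec; yes; no; does)
open import Relation.Nullary.Decidable using (dec-true; toWitness; ¬?; _×-dec_; _→-dec_; _⊎-dec_; map′)

private variable
  n : ℕ
  V : Set
  x y z : V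

-- Booleans and decidable subsets

clash : ∀ {b} → b ≡ true → b ≡ false → ⊥
clash refl ()

does⁻ : ∀ {P : Set} (P? : Dec P) → does P? ≡ true → P
does⁻ (yes p) _ = p

subset : {P : Fin n → Set} → (∀ x → Dec (P x)) → Subset n
subset P? = tabulate (does ∘ P?)

∈-subset⁺ : {P : Fin n → Set} (P? : ∀ x → Dec (P x)) → P x → x ∈ subset P?
∈-subset⁺ P? p = lookup⇒[]= _ _ (trans (lookup∘tabulate (does ∘ P?) _) (dec-true (P? _) p))

∈-subset⁻ : {P : Fin n → Set} (P? : ∀ x → Dec (P x)) → x ∈ subset P? → P x
∈-subset⁻ P? m = does⁻ (P? _) (trans (sym (lookup∘tabulate (does ∘ P?) _)) ([]=⇒lookup m))

-- Induced paths on four vertices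

-- The six values already force the vertices to be distinct, even when `E` has loops, as the
-- complement `co` of a graph does.
record P4 (E : V → V → Bool) (a b c d : V) : Set where
  constructor p4
  field
    ab : E a b ≡ true
    bc : E b c ≡ true
    cd : E c d ≡ true
    ac : E a c ≡ false
    bd : E b d ≡ false
    ad : E a d ≡ false

NoP4 : (Fin n → Fin n → Bool) → Subset n → Set
NoP4 E S = ∀ {a b c d} → a ∈ S → b ∈ S → c ∈ S → d ∈ S → ¬ P4 E a b c d

-- By reversing paths, it suffices to exclude x as the second vertex.
NonMid : (Fin n → Fin n → Bool) → Subset n → Fin n → Set
NonMid E S x = ∀ {a c d} → a ∈ S → c ∈ S → d ∈ S → ¬ P4 E a x c d

co : (V → V → Bool) → V → V → Bool
co E x y = not (E x y)

module _ {E : V → V → Bool} (E-sym : ∀ x y → E x y ≡ E y x) where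

  E-flip : ∀ {b} → E x y ≡ b → E y x ≡ b
  E-flip = trans (E-sym _ _)

  co-sym : ∀ x y → co E x y ≡ co E y x
  co-sym x y = cong not (E-sym x y)

  P4-reverse : ∀ {a b c d} → P4 E a b c d → P4 E d c b a
  P4-reverse (p4 ab bc cd ac bd ad) =
    p4 (E-flip cd) (E-flip bc) (E-flip ab) (E-flip bd) (E-flip ac) (E-flip ad)

  P4-co : ∀ {a b c d} → P4 E a b c d → P4 (co E) b d a c
  P4-co (p4 ab bc cd ac bd ad) =
    p4 (cong not bd) (cong not (E-flip ad)) (cong not ac)
       (cong not (E-flip ab)) (cong not (E-flip cd)) (cong not bc)

  P4-co⁻ : ∀ {a b c d} → P4 (co E) a b c d → P4 E b d a c
  P4-co⁻ (p4 ab bc cd ac bd ad) =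
    p4 (un bd) (un (cong not (E-flip (un ad)))) (un ac)
       (un (cong not (E-flip (un ab)))) (un (cong not (E-flip (un cd)))) (un bc)
    where
    un : ∀ {u v b} → co E u v ≡ b → E u v ≡ not b
    un e = trans (sym (not-involutive _)) (cong not e)

  P4-a≢b : ∀ {a b c d} → P4 E a b c d → a ≢ b
  P4-a≢b p refl = clash (P4.bc p) (P4.ac p)

  P4-b≢c : ∀ {a b c d} → P4 E a b c d → b ≢ c
  P4-b≢c p refl = clash (P4.ab p) (P4.ac p)

  P4-b≢d : ∀ {a b c d} → P4 E a b c d → b ≢ d
  P4-b≢d p refl = clash (P4.ab p) (P4.ad p)

  P4-a≢c : ∀ {a b c d} → P4 E a b c d → a ≢ c
  P4-a≢c p refl = clash (P4.cd p) (P4.ad p)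

-- Gluing two P4-free graphs at a vertex

record Glued (E : Fin n → Fin n → Bool) (S X Y : Subset n) : Set where
  field
    X⊆S   : X ⊆ S
    Y⊆S   : Y ⊆ S
    cover : x ∈ S → x ∈ X ⊎ x ∈ Y
    freeX : NoP4 E X
    freeY : NoP4 E Y
    meet  : x ∈ X → x ∈ Y → y ∈ X → y ∈ Y → x ≡ y
    cross : x ∈ X → x ∉ Y → y ∈ Y → y ∉ X → E x y ≡ false

-- Up to reversal and exchange of the parts, this is the only shape of a P4 in a glued graph: one
-- vertex on one side of the shared vertex, two on the other.
record Cut (X Y : Subset n) (a b c d : Fin n) : Set where
  constructor cut
  field
    b∈X : b ∈ X
    b∈Y : b ∈ Y
    a∈X : a ∈ X
    a∉Y : a ∉ Y
    c∈Y : c ∈ Y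
    c∉X : c ∉ X
    d∈Y : d ∈ Y
    d∉X : d ∉ X

data Side (X Y : Subset n) (x : Fin n) : Set where
  onX  : x ∈ X → x ∉ Y → Side X Y x
  onY  : x ∈ Y → x ∉ X → Side X Y x
  both : x ∈ X → x ∈ Y → Side X Y x

module _ {E : Fin n → Fin n → Bool} (E-sym : ∀ x y → E x y ≡ E y x) where

  Glued-swap : ∀ {S X Y} → Glued E S X Y → Glued E S Y X
  Glued-swap g = record
    { X⊆S = Y⊆S ; Y⊆S = X⊆S ; cover = λ s → swap (cover s)
    ; freeX = freeY ; freeY = freeX ; meet = λ p q r s → meet q p s r
    ; cross = λ p q r s → E-flip E-sym (cross r s p q) }
    where open Glued g

  module _ {S X Y : Subset n} (g : Glued E S X Y) where
    open Glued g

    side : x ∈ S → Side X Y x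
    side {x} s with x ∈? X | x ∈? Y
    ... | yes p | yes q = both p q
    ... | yes p | no q  = onX p q
    ... | no p  | yes q = onY q p
    ... | no p  | no q with cover s
    ...   | inj₁ r = ⊥-elim (p r)
    ...   | inj₂ r = ⊥-elim (q r)

    cross′ : ∀ {x y b} → x ∈ X → x ∉ Y → y ∈ Y → y ∉ X → E y x ≡ b → b ≡ true → ⊥
    cross′ p q r s e refl = clash e (E-flip E-sym (cross p q r s))

    CutEither : (a b c d : Fin n) → Set
    CutEither a b c d = Cut X Y a b c d ⊎ Cut Y X a b c d

    central : ∀ {a b c d} → P4 E a b c d → a ∈ S → c ∈ S → d ∈ S →
      b ∈ X → b ∈ Y → CutEither a b c d
    central p sa sc sd bX bY with side sa | side sc | side sd
    ... | both u v | _ | _ = ⊥-elim (P4-a≢b E-sym p (meet u v bX bY))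
    ... | _ | both u v | _ = ⊥-elim (P4-b≢c E-sym p (meet bX bY u v))
    ... | _ | _ | both u v = ⊥-elim (P4-b≢d E-sym p (meet bX bY u v))
    ... | onX a _ | onX c _ | onX d _ = ⊥-elim (freeX a bX c d p)
    ... | onY a _ | onY c _ | onY d _ = ⊥-elim (freeY a bY c d p)
    ... | _ | onX u v | onY u′ v′ = ⊥-elim (clash (P4.cd p) (cross u v u′ v′))
    ... | _ | onY u v | onX u′ v′ = ⊥-elim (cross′ u′ v′ u v (P4.cd p) refl)
    ... | onX a a′ | onY c c′ | onY d d′ = inj₁ (cut bX bY a a′ c c′ d d′)
    ... | onY a a′ | onX c c′ | onX d d′ = inj₂ (cut bY bX a a′ c c′ d d′)

    -- Edges leave a part only through the shared vertex. Were both midpoints different from it,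
    -- they would lie in one part and draw their neighbours into that part, which is P4-free. So the
    -- shared vertex is a midpoint, and `central` places the rest.
    P4-cut : ∀ {a b c d} → P4 E a b c d → a ∈ S → b ∈ S → c ∈ S → d ∈ S →
      CutEither a b c d ⊎ CutEither d c b a
    P4-cut p sa sb sc sd with side sb | side sc
    ... | both u v | _ = inj₁ (central p sa sc sd u v)
    ... | _ | both u v = inj₂ (central (P4-reverse E-sym p) sd sb sa u v)
    ... | onX u v | onY u′ v′ = ⊥-elim (clash (P4.bc p) (cross u v u′ v′))
    ... | onY u v | onX u′ v′ = ⊥-elim (cross′ u′ v′ u v (P4.bc p) refl)
    ... | onX u v | onX u′ v′ = ⊥-elim (freeX a∈ u u′ d∈ p)
      where
      a∈ : _ ∈ X
      a∈ with side sa
      ... | onX r _ = r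
      ... | both r _ = r
      ... | onY r s = ⊥-elim (cross′ u v r s (P4.ab p) refl)
      d∈ : _ ∈ X
      d∈ with side sd
      ... | onX r _ = r
      ... | both r _ = r
      ... | onY r s = ⊥-elim (clash (P4.cd p) (cross u′ v′ r s))
    ... | onY u v | onY u′ v′ = ⊥-elim (freeY a∈ u u′ d∈ p)
      where
      a∈ : _ ∈ Y
      a∈ with side sa
      ... | onY r _ = r
      ... | both _ r = r
      ... | onX r s = ⊥-elim (clash (P4.ab p) (cross r s u v))
      d∈ : _ ∈ Y
      d∈ with side sd
      ... | onY r _ = r
      ... | both _ r = r
      ... | onX r s = ⊥-elim (cross′ r s u′ v′ (P4.cd p) refl)

-- Vertices that are not midpoints

-- Two distinct non-midpoints, or equivalently: one avoiding any prescribed vertex v.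
Elim : (Fin n → Fin n → Bool) → Subset n → Set
Elim E S = ∀ v y → y ∈ S → y ≢ v → ∃[ x ] (x ∈ S × x ≢ v × NonMid E S x)

private
  choose : ∀ {P : Fin n → Set} {x y} → x ≢ y → P x → P y → ∀ v → ∃[ z ] (z ≢ v × P z)
  choose {x = x} {y} x≢y px py v with x ≟ v
  ... | yes refl = y , (λ e → x≢y (sym e)) , py
  ... | no x≢v  = x , x≢v , px

module _ {E : Fin n → Fin n → Bool} (E-sym : ∀ x y → E x y ≡ E y x)
         {S X Y : Subset n} where

  -- A non-neighbour of h in X ∖ Y if there is one, else any vertex of X ∖ Y.
  nonMid-side : ∀ {h} → Glued E S X Y → h ∈ X → h ∈ Y →
    (∃[ a ] (a ∈ X × a ∉ Y)) → ∃[ x ] (x ∈ X × x ∉ Y × NonMid E S x)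
  nonMid-side {h} g hX hY (a₀ , a₀X , a₀Y)
    with any? (λ a → (a ∈? X) ×-dec ¬? (a ∈? Y) ×-dec (E a h Bool.≟ false))
  ... | yes (a , aX , aY , ah) = a , aX , aY , nm
    where
    open Glued g
    nm : NonMid E S a
    nm sx sc sd p with P4-cut E-sym g p sx (X⊆S aX) sc sd
    ... | inj₁ (inj₁ k) = aY (Cut.b∈Y k)
    ... | inj₁ (inj₂ k) = aY (Cut.b∈X k)
    ... | inj₂ (inj₁ k) = aY (Cut.c∈Y k)
    ... | inj₂ (inj₂ k) = clash (P4.bc p) (subst (λ w → E a w ≡ false) (meet hX hY (Cut.b∈Y k) (Cut.b∈X k)) ah)
  ... | no none = a₀ , a₀X , a₀Y , nm
    where
    open Glued g
    nm : NonMid E S a₀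
    nm sx sc sd p with P4-cut E-sym g p sx (X⊆S a₀X) sc sd
    ... | inj₁ (inj₁ k) = a₀Y (Cut.b∈Y k)
    ... | inj₁ (inj₂ k) = a₀Y (Cut.b∈X k)
    ... | inj₂ (inj₁ k) = a₀Y (Cut.c∈Y k)
    ... | inj₂ (inj₂ k) = none (_ , Cut.d∈Y k , Cut.d∉X k ,
      subst (λ w → E _ w ≡ false) (meet (Cut.b∈Y k) (Cut.b∈X k) hX hY) (P4.ac p))

-- Without a shared vertex, or with one part contained in the other, there is no P4 and any vertex
-- serves. Otherwise each side supplies a non-midpoint outside the other part, and one of the two
-- differs from `v`.
elim-glued : {E : Fin n → Fin n → Bool} → (∀ x y → E x y ≡ E y x) →
  {S X Y : Subset n} → Glued E S X Y → Elim E S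
elim-glued {E = E} E-sym {S} {X} {Y} g v y₀ y₀∈S y₀≢v
  with any? (λ h → (h ∈? X) ×-dec (h ∈? Y))
     | any? (λ a → (a ∈? X) ×-dec ¬? (a ∈? Y))
     | any? (λ b → (b ∈? Y) ×-dec ¬? (b ∈? X))
... | no noH | _ | _ = y₀ , y₀∈S , y₀≢v , nm
  where
  nm : NonMid E S y₀
  nm sa sc sd p with P4-cut E-sym g p sa y₀∈S sc sd
  ... | inj₁ (inj₁ k) = noH (_ , Cut.b∈X k , Cut.b∈Y k)
  ... | inj₁ (inj₂ k) = noH (_ , Cut.b∈Y k , Cut.b∈X k)
  ... | inj₂ (inj₁ k) = noH (_ , Cut.b∈X k , Cut.b∈Y k)
  ... | inj₂ (inj₂ k) = noH (_ , Cut.b∈Y k , Cut.b∈X k)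
... | yes _ | no noA | _ = y₀ , y₀∈S , y₀≢v , nm
  where
  nm : NonMid E S y₀
  nm sa sc sd p with P4-cut E-sym g p sa y₀∈S sc sd
  ... | inj₁ (inj₁ k) = noA (_ , Cut.a∈X k , Cut.a∉Y k)
  ... | inj₁ (inj₂ k) = noA (_ , Cut.c∈Y k , Cut.c∉X k)
  ... | inj₂ (inj₁ k) = noA (_ , Cut.a∈X k , Cut.a∉Y k)
  ... | inj₂ (inj₂ k) = noA (_ , Cut.c∈Y k , Cut.c∉X k)
... | yes _ | yes _ | no noB = y₀ , y₀∈S , y₀≢v , nm
  where
  nm : NonMid E S y₀
  nm sa sc sd p with P4-cut E-sym g p sa y₀∈S sc sd
  ... | inj₁ (inj₁ k) = noB (_ , Cut.c∈Y k , Cut.c∉X k)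
  ... | inj₁ (inj₂ k) = noB (_ , Cut.a∈X k , Cut.a∉Y k)
  ... | inj₂ (inj₁ k) = noB (_ , Cut.c∈Y k , Cut.c∉X k)
  ... | inj₂ (inj₂ k) = noB (_ , Cut.a∈X k , Cut.a∉Y k)
... | yes (h , hX , hY) | yes A | yes B
  with nonMid-side E-sym g hX hY A | nonMid-side E-sym (Glued-swap E-sym g) hY hX B
... | xa , aX , aY , na | xb , bY , bX , nb
  with choose {P = λ x → x ∈ S × NonMid E S x} {xa} {xb} (λ { refl → aY bY })
         (Glued.X⊆S g aX , na) (Glued.Y⊆S g bY , nb) v
... | x , x≢v , x∈S , nx = x , x∈S , x≢v , nx

-- Gluing in the complement, and houses

house : {G : Graph n} {a′ a h b b′ : Fin n} → let E = co (adj G) in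
  E a′ a ≡ true → E a h ≡ true → E h b ≡ true → E b b′ ≡ true →
  E a′ h ≡ false → E a′ b ≡ false → E a′ b′ ≡ false →
  E a b ≡ false → E a b′ ≡ false → E h b′ ≡ false → HasInducedHouse G
house {G = G} {a′} {a} {h} {b} {b′} e₀₁ e₁₂ e₂₃ e₃₄ e₀₂ e₀₃ e₀₄ e₁₃ e₁₄ e₂₄ =
  f , inj , pat
  where
  pattern 0F = zero
  pattern 1F = suc zero
  pattern 2F = suc (suc zero)
  pattern 3F = suc (suc (suc zero))
  pattern 4F = suc (suc (suc (suc zero)))

  un : ∀ {u v b} → not (adj G u v) ≡ b → adj G u v ≡ not b
  un e = trans (sym (not-involutive _)) (cong not e)

  un′ : ∀ {u v b} → not (adj G u v) ≡ b → adj G v u ≡ not b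
  un′ e = trans (adj-sym G _ _) (un e)

  f : Fin 5 → Fin _
  f 0F = a′
  f 1F = a
  f 2F = h
  f 3F = b
  f 4F = b′

  pat : ∀ i j → adj G (f i) (f j) ≡ houseAdj i j
  pat 0F 0F = adj-irrefl G _
  pat 0F 1F = un e₀₁
  pat 0F 2F = un e₀₂
  pat 0F 3F = un e₀₃
  pat 0F 4F = un e₀₄
  pat 1F 0F = un′ e₀₁
  pat 1F 1F = adj-irrefl G _
  pat 1F 2F = un e₁₂
  pat 1F 3F = un e₁₃
  pat 1F 4F = un e₁₄
  pat 2F 0F = un′ e₀₂
  pat 2F 1F = un′ e₁₂
  pat 2F 2F = adj-irrefl G _
  pat 2F 3F = un e₂₃
  pat 2F 4F = un e₂₄
  pat 3F 0F = un′ e₀₃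
  pat 3F 1F = un′ e₁₃
  pat 3F 2F = un′ e₂₃
  pat 3F 3F = adj-irrefl G _
  pat 3F 4F = un e₃₄
  pat 4F 0F = un′ e₀₄
  pat 4F 1F = un′ e₁₄
  pat 4F 2F = un′ e₂₄
  pat 4F 3F = un′ e₃₄
  pat 4F 4F = adj-irrefl G _

  -- No two vertices of the house have the same neighbours, so a map that reproduces its adjacencies
  -- is injective.
  twinFree : ∀ i j → (∀ k → houseAdj i k ≡ houseAdj j k) → i ≡ j
  twinFree = toWitness {a? = all? λ i → all? λ j →
    (all? λ k → houseAdj i k Bool.≟ houseAdj j k) →-dec (i ≟ j)} _

  inj : ∀ {i j} → f i ≡ f j → i ≡ j
  inj {i} {j} e = twinFree i j λ k →
    trans (sym (pat i k)) (trans (cong (λ u → adj G u (f k)) e) (pat j k))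

module _ (G : Graph n) (noHouse : ¬ HasInducedHouse G) where

  private
    E : Fin n → Fin n → Bool
    E = co (adj G)

    E-sym : ∀ x y → E x y ≡ E y x
    E-sym = co-sym (adj-sym G)

  -- A path h - a - a′ of the complement that leaves the shared vertex into one part. Tails on both
  -- sides join at `h` to an induced P5, the complement of the house.
  Tail : (X Y : Subset n) (h : Fin n) → Fin n → Fin n → Set
  Tail X Y h a a′ = a ∈ X × a ∉ Y × a′ ∈ X × a′ ∉ Y ×
    E h a ≡ true × E a a′ ≡ true × E h a′ ≡ false

  tail? : ∀ X Y h → Dec (∃[ a ] ∃[ a′ ] Tail X Y h a a′)
  tail? X Y h = any? λ a → any? λ a′ →
    (a ∈? X) ×-dec ¬? (a ∈? Y) ×-dec (a′ ∈? X) ×-dec ¬? (a′ ∈? Y) ×-dec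
    (E h a Bool.≟ true) ×-dec (E a a′ Bool.≟ true) ×-dec (E h a′ Bool.≟ false)

  -- The midpoints of a P4 are the endpoints of the complementary P4.
  nonEnd⇒nonMid : ∀ {S x} → (∀ {p q r} → p ∈ S → q ∈ S → r ∈ S → ¬ P4 E x p q r) →
    NonMid (adj G) S x
  nonEnd⇒nonMid ne a∈ c∈ d∈ p = ne d∈ a∈ c∈ (P4-co (adj-sym G) p)

  -- Every P4 of `E` consists of a neighbour of `h` on one side, `h` itself, and a tail on the
  -- other. With no tail in `X`, neither `h` nor a neighbour of `h` in `Y` outside `X` is ever an
  -- end; if there is no such neighbour, there is no P4.
  elim-glued-tailless : ∀ {S X Y h} → Glued E S X Y → h ∈ X → h ∈ Y →
    ¬ (∃[ a ] ∃[ a′ ] Tail X Y h a a′) → Elim (adj G) S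
  elim-glued-tailless {S} {X} {Y} {h} g hX hY noTail v y₀ y₀∈S y₀≢v
    with any? (λ b → (b ∈? Y) ×-dec ¬? (b ∈? X) ×-dec (E h b Bool.≟ true))
  ... | no noB = y₀ , y₀∈S , y₀≢v , nonEnd⇒nonMid ne
    where
    open Glued g
    ne : ∀ {p q r} → p ∈ S → q ∈ S → r ∈ S → ¬ P4 E y₀ p q r
    noTailAt : ∀ {k a a′} → k ∈ X → k ∈ Y → a ∈ X → a ∉ Y → a′ ∈ X → a′ ∉ Y →
      E k a ≡ true → E a a′ ≡ true → E k a′ ≡ false → ⊥
    noTailAt kX kY aX aY bX bY e₁ e₂ e₃ with refl ← meet kX kY hX hY =
      noTail (_ , _ , aX , aY , bX , bY , e₁ , e₂ , e₃)
    noNbr : ∀ {k b} → k ∈ X → k ∈ Y → b ∈ Y → b ∉ X → E k b ≡ true → ⊥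
    noNbr kX kY bY bX e with refl ← meet kX kY hX hY = noB (_ , bY , bX , e)
    ne sp sq sr P with P4-cut E-sym g P y₀∈S sp sq sr
    ... | inj₁ (inj₁ k) = noNbr (Cut.b∈X k) (Cut.b∈Y k) (Cut.c∈Y k) (Cut.c∉X k) (P4.bc P)
    ... | inj₁ (inj₂ k) = noTailAt (Cut.b∈Y k) (Cut.b∈X k) (Cut.c∈Y k) (Cut.c∉X k)
                            (Cut.d∈Y k) (Cut.d∉X k) (P4.bc P) (P4.cd P) (P4.bd P)
    ... | inj₂ (inj₁ k) = noNbr (Cut.b∈X k) (Cut.b∈Y k) (Cut.c∈Y k) (Cut.c∉X k) (E-flip E-sym (P4.bc P))
    ... | inj₂ (inj₂ k) = noTailAt (Cut.b∈Y k) (Cut.b∈X k) (Cut.c∈Y k) (Cut.c∉X k)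
                            (Cut.d∈Y k) (Cut.d∉X k) (E-flip E-sym (P4.bc P)) (E-flip E-sym (P4.ab P))
                            (E-flip E-sym (P4.ac P))
  ... | yes (b , bY , bX , hb)
    with choose {P = λ x → x ∈ S × NonMid (adj G) S x} {h} {b} (λ { refl → bX hX })
           (Glued.X⊆S g hX , nonEnd⇒nonMid neH) (Glued.Y⊆S g bY , nonEnd⇒nonMid neB) v
    where
    open Glued g
    noTailAt : ∀ {k a a′} → k ∈ X → k ∈ Y → a ∈ X → a ∉ Y → a′ ∈ X → a′ ∉ Y →
      E k a ≡ true → E a a′ ≡ true → E k a′ ≡ false → ⊥
    noTailAt kX kY aX aY bX bY e₁ e₂ e₃ with refl ← meet kX kY hX hY =
      noTail (_ , _ , aX , aY , bX , bY , e₁ , e₂ , e₃)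
    neH : ∀ {p q r} → p ∈ S → q ∈ S → r ∈ S → ¬ P4 E h p q r
    neH sp sq sr P with P4-cut E-sym g P (X⊆S hX) sp sq sr
    ... | inj₁ (inj₁ k) = Cut.a∉Y k hY
    ... | inj₁ (inj₂ k) = Cut.a∉Y k hX
    ... | inj₂ (inj₁ k) = Cut.d∉X k hX
    ... | inj₂ (inj₂ k) = Cut.d∉X k hY
    neB : ∀ {p q r} → p ∈ S → q ∈ S → r ∈ S → ¬ P4 E b p q r
    neB sp sq sr P with P4-cut E-sym g P (Y⊆S bY) sp sq sr
    ... | inj₁ (inj₁ k) = bX (Cut.a∈X k)
    ... | inj₁ (inj₂ k) = noTailAt (Cut.b∈Y k) (Cut.b∈X k) (Cut.c∈Y k) (Cut.c∉X k)
                            (Cut.d∈Y k) (Cut.d∉X k) (P4.bc P) (P4.cd P) (P4.bd P)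
    ... | inj₂ (inj₁ k) = clash (E-flip E-sym hb)
                            (subst (λ w → E b w ≡ false) (meet (Cut.b∈X k) (Cut.b∈Y k) hX hY) (P4.ac P))
    ... | inj₂ (inj₂ k) = bX (Cut.d∈Y k)
  ... | x , x≢v , x∈S , nx = x , x∈S , x≢v , nx

  elim-co-glued : ∀ {S X Y} → Glued E S X Y → Elim (adj G) S
  elim-co-glued {S} {X} {Y} g v y₀ y₀∈S y₀≢v
    with any? (λ h → (h ∈? X) ×-dec (h ∈? Y))
  ... | no noH = y₀ , y₀∈S , y₀≢v , nonEnd⇒nonMid ne
    where
    ne : ∀ {p q r} → p ∈ S → q ∈ S → r ∈ S → ¬ P4 E y₀ p q r
    ne sp sq sr P with P4-cut E-sym g P y₀∈S sp sq sr
    ... | inj₁ (inj₁ k) = noH (_ , Cut.b∈X k , Cut.b∈Y k)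
    ... | inj₁ (inj₂ k) = noH (_ , Cut.b∈Y k , Cut.b∈X k)
    ... | inj₂ (inj₁ k) = noH (_ , Cut.b∈X k , Cut.b∈Y k)
    ... | inj₂ (inj₂ k) = noH (_ , Cut.b∈Y k , Cut.b∈X k)
  ... | yes (h , hX , hY) with tail? X Y h | tail? Y X h
  ... | no noA | _ = elim-glued-tailless g hX hY noA v y₀ y₀∈S y₀≢v
  ... | yes _ | no noB =
    elim-glued-tailless (Glued-swap E-sym g) hY hX noB v y₀ y₀∈S y₀≢v
  ... | yes (a , a′ , aX , aY , a′X , a′Y , ha , aa′ , ha′)
      | yes (b , b′ , bY , bX , b′Y , b′X , hb , bb′ , hb′) =
    ⊥-elim (noHouse (house {G = G} (E-flip E-sym aa′) (E-flip E-sym ha) hb bb′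
      (E-flip E-sym ha′) (cross a′X a′Y bY bX) (cross a′X a′Y b′Y b′X)
      (cross aX aY bY bX) (cross aX aY b′Y b′X) hb′))
    where open Glued g

-- Modules

record Module (E : Fin n → Fin n → Bool) (S M : Subset n) : Set where
  constructor mod
  field
    M⊆S     : ∀ {x} → x ∈ M → x ∈ S
    uniform : ∀ x y y′ → x ∈ S → x ∉ M → y ∈ M → y′ ∈ M → E x y ≡ E x y′

Nontrivial : (S M : Subset n) → Set
Nontrivial S M = (∃[ y ] ∃[ y′ ] (y ∈ M × y′ ∈ M × y ≢ y′)) × (∃[ z ] (z ∈ S × z ∉ M))

Prime : (Fin n → Fin n → Bool) → Subset n → Set
Prime E S = ∀ M → Module E S M → ¬ Nontrivial S M

module? : (E : Fin n → Fin n → Bool) (S M : Subset n) → Dec (Module E S M)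
module? E S M with M ⊆? S
  | all? (λ x → all? λ y → all? λ y′ → (x ∈? S) →-dec ¬? (x ∈? M) →-dec (y ∈? M) →-dec
           (y′ ∈? M) →-dec (E x y Bool.≟ E x y′))
... | yes p | yes q = yes (mod p q)
... | no p | _ = no λ m → p (Module.M⊆S m)
... | yes _ | no q = no λ m → q (Module.uniform m)

nontrivial? : (S M : Subset n) → Dec (Nontrivial S M)
nontrivial? S M =
  (any? λ y → any? λ y′ → (y ∈? M) ×-dec (y′ ∈? M) ×-dec ¬? (y ≟ y′)) ×-dec
  (any? λ z → (z ∈? S) ×-dec ¬? (z ∈? M))

module _ {E : Fin n → Fin n → Bool} (E-sym : ∀ x y → E x y ≡ E y x)
         {S M : Subset n} (μ : Module E S M) where

  private
    -- A vertex outside a module cannot tell its members apart. By repeated use, any two vertices of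
    -- a P4 that lie in `M` pull the other two in.
    separated : y ∈ M → z ∈ M → x ∈ S → E y x ≡ true → E z x ≡ false → x ∈ M
    separated {x = x} y∈ z∈ x∈ yx zx with x ∈? M
    ... | yes p = p
    ... | no p = ⊥-elim (clash (E-flip E-sym yx)
                   (trans (Module.uniform μ _ _ _ x∈ p y∈ z∈) (E-flip E-sym zx)))

    AllIn : (a b c d : Fin n) → Set
    AllIn a b c d = a ∈ M × b ∈ M × c ∈ M × d ∈ M

    from-ab : ∀ {a b c d} → P4 E a b c d → c ∈ S → d ∈ S → a ∈ M → b ∈ M → AllIn a b c d
    from-ab p c∈ d∈ a b = a , b , c , separated c b d∈ (P4.cd p) (P4.bd p)
      where c = separated b a c∈ (P4.bc p) (P4.ac p)

    from-ac : ∀ {a b c d} → P4 E a b c d → b ∈ S → d ∈ S → a ∈ M → c ∈ M → AllIn a b c d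
    from-ac p b∈ d∈ a c =
      a , separated a d b∈ (P4.ab p) (E-flip E-sym (P4.bd p)) , c , d
      where d = separated c a d∈ (P4.cd p) (P4.ad p)

    from-bc : ∀ {a b c d} → P4 E a b c d → a ∈ S → d ∈ S → b ∈ M → c ∈ M → AllIn a b c d
    from-bc p a∈ d∈ b c =
      separated b c a∈ (E-flip E-sym (P4.ab p)) (E-flip E-sym (P4.ac p)) , b , c ,
      separated c b d∈ (P4.cd p) (P4.bd p)

    from-ad : ∀ {a b c d} → P4 E a b c d → b ∈ S → c ∈ S → a ∈ M → d ∈ M → AllIn a b c d
    from-ad p b∈ c∈ a d = a , separated a d b∈ (P4.ab p) (E-flip E-sym (P4.bd p)) ,
      separated d a c∈ (E-flip E-sym (P4.cd p)) (P4.ac p) , d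

    rev : ∀ {a b c d} → AllIn a b c d → AllIn d c b a
    rev (a , b , c , d) = d , c , b , a

  -- A P4 is prime, hence meets a module in at most one vertex unless it is contained in it.
  module _ {a b c d : Fin n} (p : P4 E a b c d)
           (a∈ : a ∈ S) (b∈ : b ∈ S) (c∈ : c ∈ S) (d∈ : d ∈ S) where

    P4-outside : ¬ AllIn a b c d →
      ¬ (a ∈ M × b ∈ M) × ¬ (b ∈ M × c ∈ M) × ¬ (c ∈ M × d ∈ M) ×
      ¬ (a ∈ M × c ∈ M) × ¬ (b ∈ M × d ∈ M) × ¬ (a ∈ M × d ∈ M)
    P4-outside ¬all =
      (λ (u , v) → ¬all (from-ab p c∈ d∈ u v)) ,
      (λ (u , v) → ¬all (from-bc p a∈ d∈ u v)) ,
      (λ (u , v) → ¬all (rev (from-ab (P4-reverse E-sym p) b∈ a∈ v u))) ,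
      (λ (u , v) → ¬all (from-ac p b∈ d∈ u v)) ,
      (λ (u , v) → ¬all (rev (from-ac (P4-reverse E-sym p) c∈ a∈ v u))) ,
      (λ (u , v) → ¬all (from-ad p b∈ c∈ u v))

  module _ {m : Fin n} (m∈M : m ∈ M) where

    collapse : Fin n → Fin n
    collapse x with x ∈? M
    ... | yes _ = m
    ... | no _  = x

    collapse-∈ : x ∈ M → collapse x ≡ m
    collapse-∈ {x} p with x ∈? M
    ... | yes _ = refl
    ... | no ¬p = ⊥-elim (¬p p)

    collapse-∉ : x ∉ M → collapse x ≡ x
    collapse-∉ {x} ¬p with x ∈? M
    ... | yes p = ⊥-elim (¬p p)
    ... | no _  = refl

    collapse-adj : ∀ {b} → x ∈ S → y ∈ S → ¬ (x ∈ M × y ∈ M) → E x y ≡ b →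
      E (collapse x) (collapse y) ≡ b
    collapse-adj {x} {y} sx sy ¬xy e with x ∈? M | y ∈? M
    ... | yes p | yes q = ⊥-elim (¬xy (p , q))
    ... | no p | no q = e
    ... | no p | yes q = trans (Module.uniform μ _ _ _ sx p m∈M q) e
    ... | yes p | no q = E-flip E-sym (trans (Module.uniform μ _ _ _ sy q m∈M p) (E-flip E-sym e))

    -- The quotient is realised inside `S` by keeping `m` as the only member of `M`, so it is an
    -- induced subgraph to which induction applies.
    quotient? : ∀ x → Dec (x ∈ S × (x ∈ M → x ≡ m))
    quotient? x = (x ∈? S) ×-dec ((x ∈? M) →-dec (x ≟ m))

    quotient : Subset n
    quotient = subset quotient?

    collapse∈quotient : x ∈ S → collapse x ∈ quotient
    collapse∈quotient {x} s with x ∈? M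
    ... | yes _ = ∈-subset⁺ quotient? (Module.M⊆S μ m∈M , λ _ → refl)
    ... | no ¬p = ∈-subset⁺ quotient? (s , λ p → ⊥-elim (¬p p))

    P4-collapse : ∀ {a b c d} → P4 E a b c d → a ∈ S → b ∈ S → c ∈ S → d ∈ S →
      ¬ AllIn a b c d → P4 E (collapse a) (collapse b) (collapse c) (collapse d)
    P4-collapse p a b c d ¬all with P4-outside p a b c d ¬all
    ... | nab , nbc , ncd , nac , nbd , nad = p4
      (collapse-adj a b nab (P4.ab p)) (collapse-adj b c nbc (P4.bc p))
      (collapse-adj c d ncd (P4.cd p)) (collapse-adj a c nac (P4.ac p))
      (collapse-adj b d nbd (P4.bd p)) (collapse-adj a d nad (P4.ad p))

    collapse-nonMid : ∀ {x} → x ∈ S → NonMid E quotient (collapse x) →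
      ∀ {a c d} → a ∈ S → c ∈ S → d ∈ S → P4 E a x c d → ¬ ¬ AllIn a x c d
    collapse-nonMid sx nm a c d p ¬all =
      nm (collapse∈quotient a) (collapse∈quotient c) (collapse∈quotient d)
         (P4-collapse p a sx c d ¬all)

  -- A non-midpoint of the quotient outside `M` is also one of `S`. If the quotient yields the
  -- representative `m`, a non-midpoint of `M` other than `v` replaces it: a P4 with that midpoint
  -- would lie in `M` or collapse to one with midpoint `m`.
  elim-module : Nontrivial S M → Elim E M →
    (∀ S′ → S′ ⊂ S → Elim E S′) → Elim E S
  elim-module ((m , m′ , m∈ , m′∈ , m≢m′) , (z , z∈S , z∉M)) elimM ih v _ _ _
    with choose {P = _∈ quotient m∈} {m} {z} (λ { refl → z∉M m∈ })
           (∈-subset⁺ (quotient? m∈) (Module.M⊆S μ m∈ , λ _ → refl))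
           (∈-subset⁺ (quotient? m∈) (z∈S , λ p → ⊥-elim (z∉M p))) v
  ... | y , y≢v , y∈Q with ih (quotient m∈) Q⊂S v y y∈Q y≢v
    where
    Q⊂S : quotient m∈ ⊂ S
    Q⊂S = (λ p → proj₁ (∈-subset⁻ (quotient? m∈) p)) , m′ , Module.M⊆S μ m′∈ ,
          λ p → m≢m′ (sym (proj₂ (∈-subset⁻ (quotient? m∈) p) m′∈))
  ... | x , x∈Q , x≢v , nm with x ∈? M
  ... | no x∉M = x , x∈S , x≢v , λ a c d p →
          collapse-nonMid m∈ x∈S (subst (NonMid E (quotient m∈)) (sym (collapse-∉ m∈ x∉M)) nm)
            a c d p (λ (_ , q , _) → x∉M q)
    where x∈S = proj₁ (∈-subset⁻ (quotient? m∈) x∈Q)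
  ... | yes x∈M with elimM v x x∈M x≢v
  ... | x′ , x′∈M , x′≢v , nm′ = x′ , x′∈S , x′≢v , λ a c d p →
          collapse-nonMid m∈ x′∈S (subst (NonMid E (quotient m∈)) x≡cx′ nm)
            a c d p (λ (a , _ , c , d) → nm′ a c d p)
    where
    x′∈S = Module.M⊆S μ x′∈M
    x≡cx′ : x ≡ collapse m∈ x′
    x≡cx′ = trans (proj₂ (∈-subset⁻ (quotient? m∈) x∈Q) x∈M) (sym (collapse-∈ m∈ x′∈M))

-- Elimination from prime subgraphs

PrimeGlued : Graph n → Set
PrimeGlued G = ∀ S → Prime (adj G) S →
  ∃[ X ] ∃[ Y ] (Glued (adj G) S X Y ⊎ Glued (co (adj G)) S X Y)

elim : (G : Graph n) → ¬ HasInducedHouse G → PrimeGlued G → ∀ S → Elim (adj G) S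
elim G noHouse pg S = go S (⊂-wellFounded S)
  where
  go : ∀ S → Acc _⊂_ S → Elim (adj G) S
  go S (acc rs) with anySubset? (λ M → module? (adj G) S M ×-dec nontrivial? S M)
  ... | yes (M , μ , nt@(_ , z , z∈S , z∉M)) = elim-module (adj-sym G) μ nt
          (go M (rs (Module.M⊆S μ , z , z∈S , z∉M))) (λ S′ S′⊂S → go S′ (rs S′⊂S))
  ... | no none with pg S (λ M μ nt → none (M , μ , nt))
  ... | _ , _ , inj₁ g = elim-glued (adj-sym G) g
  ... | _ , _ , inj₂ g = elim-co-glued G noHouse g

-- Brittleness and very strong perfection

module _ {G : Graph n} where

  induced-P4 : ∀ {S f} → InducedCopyIn G S (pathAdj {4}) f →
    P4 (adj G) (f zero) (f (suc zero)) (f (suc (suc zero))) (f (suc (suc (suc zero))))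
  induced-P4 (_ , _ , pat) = p4 (pat _ _) (pat _ _) (pat _ _) (pat _ _) (pat _ _) (pat _ _)

  nonMid⇒¬MidpointP4 : ∀ {S x} → NonMid (adj G) S x → ¬ MidpointP4 G S x
  nonMid⇒¬MidpointP4 nm (f , copy@(_ , f∈ , _) , inj₁ refl) =
    nm (f∈ _) (f∈ _) (f∈ _) (induced-P4 copy)
  nonMid⇒¬MidpointP4 nm (f , copy@(_ , f∈ , _) , inj₂ refl) =
    nm (f∈ _) (f∈ _) (f∈ _) (P4-reverse (adj-sym G) (induced-P4 copy))

module _ (G : Graph n) (el : ∀ S → Elim (adj G) S) where

  brittle : Brittle G
  brittle S (v , v∈S) with any? (λ y → (y ∈? S) ×-dec ¬? (y ≟ v))
  ... | yes (y , y∈S , y≢v) with el S v y y∈S y≢v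
  ...   | x , x∈S , _ , nm = x , x∈S , inj₁ (nonMid⇒¬MidpointP4 {G = G} nm)
  brittle S (v , v∈S) | no single = v , v∈S , inj₁ (nonMid⇒¬MidpointP4 {G = G} nm)
    where
    nm : NonMid (adj G) S v
    nm a∈S _ _ p = single (_ , a∈S , P4-a≢b (adj-sym G) p)

  Complete : Fin n → Subset n → Set
  Complete p Q = ∀ {q} → q ∈ Q → Edge G p q

  -- Domination is asked of all cliques missing `T`, because a maximal clique may lose maximality
  -- when a vertex is deleted and the property has to be carried back from the smaller set. Applied
  -- to a maximal clique, it yields a vertex shared with `T`.
  record Strong (S T : Subset n) : Set where
    field
      T⊆S       : ∀ {x} → x ∈ T → x ∈ S
      stable    : ∀ {x y} → x ∈ T → y ∈ T → ¬ Edge G x y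
      dominates : ∀ Q → CliqueIn G S Q → (∀ {q} → q ∈ Q → q ∉ T) → ∃[ p ] (p ∈ T × Complete p Q)

  delete? : (S : Subset n) (x : Fin n) → ∀ y → Dec (y ∈ S × y ≢ x)
  delete? S x y = (y ∈? S) ×-dec ¬? (y ≟ x)

  delete : Subset n → Fin n → Subset n
  delete S x = subset (delete? S x)

  insert? : (T : Subset n) (x : Fin n) → ∀ y → Dec (y ∈ T ⊎ y ≡ x)
  insert? T x y = (y ∈? T) ⊎-dec (y ≟ x)

  -- If p misses x, t misses q and q ∈ Q, then t – x – q – p is an induced path with midpoint x.
  strong-extend : ∀ {S T x} → x ∈ S → NonMid (adj G) S x → Strong (delete S x) T →
    ∃[ t ] (t ∈ T × Edge G x t) → Strong S T
  strong-extend {S} {T} {x} x∈S nm st (t , t∈T , xt) = record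
    { T⊆S = sub ; stable = stable ; dominates = dom }
    where
    open Strong st
    sub : y ∈ T → y ∈ S
    sub = proj₁ ∘ ∈-subset⁻ (delete? S x) ∘ T⊆S
    dom : ∀ Q → CliqueIn G S Q → (∀ {q} → q ∈ Q → q ∉ T) → ∃[ p ] (p ∈ T × Complete p Q)
    dom Q (Q⊆S , clique) disj with x ∈? Q
    ... | no x∉Q = dominates Q
          ((λ q → ∈-subset⁺ (delete? S x) (Q⊆S q , λ { refl → x∉Q q })) , clique) disj
    -- Some `p` dominates `Q` without `x`. It dominates `Q` if adjacent to `x`; otherwise the
    -- neighbour `t` of `x` does, for a missed `q` would make `x` a midpoint.
    ... | yes x∈Q with dominates (delete Q x)
          ((λ q → let (r , s) = ∈-subset⁻ (delete? Q x) q in ∈-subset⁺ (delete? S x) (Q⊆S r , s)) ,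
           (λ u v p q → clique u v (proj₁ (∈-subset⁻ (delete? Q x) p)) (proj₁ (∈-subset⁻ (delete? Q x) q))))
          (disj ∘ proj₁ ∘ ∈-subset⁻ (delete? Q x))
    ... | p , p∈T , pQ with adj G p x in px
    ... | true = p , p∈T , full
      where
      full : Complete p Q
      full {q} q∈Q with q ≟ x
      ... | yes refl = px
      ... | no q≢x = pQ (∈-subset⁺ (delete? Q x) (q∈Q , q≢x))
    ... | false with any? (λ q → delete? Q x q ×-dec (adj G t q Bool.≟ false))
    ... | no none = t , t∈T , full
      where
      full : Complete t Q
      full {q} q∈Q with q ≟ x
      ... | yes refl = E-flip (adj-sym G) xt
      ... | no q≢x with adj G t q in tq
      ...   | true = refl
      ...   | false = ⊥-elim (none (q , (q∈Q , q≢x) , tq))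
    ... | yes (q , (q∈Q , q≢x) , tq) = ⊥-elim (nm (sub t∈T) (Q⊆S q∈Q) (sub p∈T)
          (p4 (E-flip (adj-sym G) xt) (clique x q x∈Q q∈Q (≢-sym q≢x))
              (E-flip (adj-sym G) (pQ (∈-subset⁺ (delete? Q x) (q∈Q , q≢x))))
              tq (E-flip (adj-sym G) px) (¬-not (stable t∈T p∈T))))

  strong-insert : ∀ {S T x} → x ∈ S → Strong (delete S x) T →
    ¬ (∃[ t ] (t ∈ T × Edge G x t)) → Strong S (subset (insert? T x))
  strong-insert {S} {T} {x} x∈S st none = record
    { T⊆S = λ t → sub (∈-subset⁻ (insert? T x) t)
    ; stable = λ p q → stab (∈-subset⁻ (insert? T x) p) (∈-subset⁻ (insert? T x) q)
    ; dominates = dom }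
    where
    open Strong st
    sub : y ∈ T ⊎ y ≡ x → y ∈ S
    sub (inj₁ t) = proj₁ (∈-subset⁻ (delete? S x) (T⊆S t))
    sub (inj₂ refl) = x∈S
    stab : ∀ {y z} → y ∈ T ⊎ y ≡ x → z ∈ T ⊎ z ≡ x → ¬ Edge G y z
    stab (inj₁ p) (inj₁ q) e = stable p q e
    stab (inj₁ p) (inj₂ refl) e = none (_ , p , E-flip (adj-sym G) e)
    stab (inj₂ refl) (inj₁ q) e = none (_ , q , e)
    stab (inj₂ refl) (inj₂ refl) e = clash e (adj-irrefl G _)
    dom : ∀ Q → CliqueIn G S Q → (∀ {q} → q ∈ Q → q ∉ subset (insert? T x)) →
      ∃[ p ] (p ∈ subset (insert? T x) × Complete p Q)
    dom Q (Q⊆S , clique) disj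
      with dominates Q ((λ q → ∈-subset⁺ (delete? S x)
                          (Q⊆S q , λ e → disj q (∈-subset⁺ (insert? T x) (inj₂ e)))) , clique)
                     (λ q t → disj q (∈-subset⁺ (insert? T x) (inj₁ t)))
    ... | p , p∈T , pQ = p , ∈-subset⁺ (insert? T x) (inj₁ p∈T) , pQ

  strong : ∀ S v → v ∈ S → ∃[ T ] (v ∈ T × Strong S T)
  strong S v v∈S = go S (⊂-wellFounded S) v∈S
    where
    go : ∀ S → Acc _⊂_ S → v ∈ S → ∃[ T ] (v ∈ T × Strong S T)
    go S (acc rs) v∈S with any? (λ y → (y ∈? S) ×-dec ¬? (y ≟ v))
    ... | no single = S , v∈S , record
      { T⊆S = λ t → t ; stable = stab
      ; dominates = λ Q (Q⊆S , _) disj → v , v∈S , λ q → ⊥-elim (disj q (Q⊆S q)) }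
      where
      only : y ∈ S → y ≡ v
      only {y} y∈S with y ≟ v
      ... | yes e = e
      ... | no ne = ⊥-elim (single (y , y∈S , ne))
      stab : ∀ {x y} → x ∈ S → y ∈ S → ¬ Edge G x y
      stab p q e with refl ← only p | refl ← only q = clash e (adj-irrefl G _)
    ... | yes (y , y∈S , y≢v) with el S v y y∈S y≢v
    ... | x , x∈S , x≢v , nm
      with go (delete S x)
              (rs ((λ p → proj₁ (∈-subset⁻ (delete? S x) p)) , x , x∈S ,
                   λ p → proj₂ (∈-subset⁻ (delete? S x) p) refl))
              (∈-subset⁺ (delete? S x) (v∈S , ≢-sym x≢v))
    ... | T , v∈T , st with any? (λ t → (t ∈? T) ×-dec (adj G x t Bool.≟ true))
    ... | yes nbr = T , v∈T , strong-extend x∈S nm st nbr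
    ... | no none = subset (insert? T x) , ∈-subset⁺ (insert? T x) (inj₁ v∈T) ,
                    strong-insert x∈S st none

  veryStronglyPerfect : VeryStronglyPerfect G
  veryStronglyPerfect S v v∈S with strong S v v∈S
  ... | T , v∈T , st = T , v∈T , (T⊆S , λ _ _ → stable) , meets
    where
    open Strong st
    meets : ∀ K → MaximalCliqueIn G S K → ∃[ u ] (u ∈ T × u ∈ K)
    meets K ((K⊆S , clique) , maximal) with any? (λ u → (u ∈? T) ×-dec (u ∈? K))
    ... | yes r = r
    ... | no none with dominates K (K⊆S , clique) (λ q t → none (_ , t , q))
    ... | p , p∈T , pK = p , p∈T ,
          maximal (subset (insert? K p))
            ((λ q → sub (∈-subset⁻ (insert? K p) q)) ,
             (λ x y q r → cl (∈-subset⁻ (insert? K p) q) (∈-subset⁻ (insert? K p) r)))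
            (λ q → ∈-subset⁺ (insert? K p) (inj₁ q))
            (∈-subset⁺ (insert? K p) (inj₂ refl))
      where
      sub : ∀ {q} → q ∈ K ⊎ q ≡ p → q ∈ S
      sub (inj₁ q) = K⊆S q
      sub (inj₂ refl) = T⊆S p∈T
      cl : ∀ {x y} → x ∈ K ⊎ x ≡ p → y ∈ K ⊎ y ≡ p → x ≢ y → Edge G x y
      cl (inj₁ q) (inj₁ r) ne = clique _ _ q r ne
      cl (inj₁ q) (inj₂ refl) _ = E-flip (adj-sym G) (pK q)
      cl (inj₂ refl) (inj₁ r) _ = pK r
      cl (inj₂ refl) (inj₂ refl) ne = ⊥-elim (ne refl)

-- Cycles

prev : ∀ {k} → Fin (suc k) → Fin (suc k)
prev zero    = fromℕ _
prev (suc i) = inject₁ i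

next : ∀ {k} (i : Fin (suc k)) → ∃[ j ] prev j ≡ i
next i with view i
... | ‵fromℕ     = zero , refl
... | ‵inject₁ j = suc j , refl

prev-injective : ∀ {k} {i j : Fin (suc k)} → prev i ≡ prev j → i ≡ j
prev-injective {i = zero}  {zero}  _ = refl
prev-injective {i = zero}  {suc j} e = ⊥-elim (fromℕ≢inject₁ e)
prev-injective {i = suc i} {zero}  e = ⊥-elim (fromℕ≢inject₁ (sym e))
prev-injective {i = suc i} {suc j} e = cong suc (inject₁-injective e)

prev-CycNext : ∀ {k} (i : Fin (suc k)) → CycNext (suc k) (prev i) i
prev-CycNext {k} zero = inj₂ (cong suc (toℕ-fromℕ k) , refl)
prev-CycNext (suc i)  = inj₁ (cong suc (toℕ-inject₁ i))

CycNext⇒prev : ∀ {k} {i j : Fin (suc k)} → CycNext (suc k) i j → i ≡ prev j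
CycNext⇒prev {j = suc j} (inj₁ e) =
  toℕ-injective (trans (ℕ.suc-injective e) (sym (toℕ-inject₁ j)))
CycNext⇒prev {k} {j = zero} (inj₂ (e , _)) =
  toℕ-injective (trans (ℕ.suc-injective e) (sym (toℕ-fromℕ k)))

module _ {k : ℕ} where

  private
    C : Set
    C = Fin (5 + k)

    prev² prev³ prev⁴ : C → C
    prev² i = prev (prev i)
    prev³ i = prev (prev² i)
    prev⁴ i = prev (prev³ i)

  -- The cycle has at least five vertices, so one to four steps back never return to the start, here
  -- and in the next three lemmas.
  prev-≢ : (i : C) → prev i ≢ i
  prev-≢ zero ()
  prev-≢ (suc i) e = ℕ.m≢1+n+m _ {n = 0} (trans (sym (toℕ-inject₁ i)) (cong toℕ e))

  prev²-≢ : (i : C) → prev² i ≢ i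
  prev²-≢ zero ()
  prev²-≢ (suc zero) ()
  prev²-≢ (suc (suc i)) e = ℕ.m≢1+n+m _ {n = 1}
    (trans (sym (trans (toℕ-inject₁ (inject₁ i)) (toℕ-inject₁ i))) (cong toℕ e))

  prev³-≢ : (i : C) → prev³ i ≢ i
  prev³-≢ zero ()
  prev³-≢ (suc zero) ()
  prev³-≢ (suc (suc zero)) ()
  prev³-≢ (suc (suc (suc i))) e = ℕ.m≢1+n+m _ {n = 2}
    (trans (sym (trans (toℕ-inject₁ (inject₁ (inject₁ i)))
                (trans (toℕ-inject₁ (inject₁ i)) (toℕ-inject₁ i)))) (cong toℕ e))

  prev⁴-≢ : (i : C) → prev⁴ i ≢ i
  prev⁴-≢ zero ()
  prev⁴-≢ (suc zero) ()
  prev⁴-≢ (suc (suc zero)) ()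
  prev⁴-≢ (suc (suc (suc zero))) ()
  prev⁴-≢ (suc (suc (suc (suc i)))) e = ℕ.m≢1+n+m _ {n = 3}
    (trans (sym (trans (toℕ-inject₁ (inject₁ (inject₁ (inject₁ i))))
                (trans (toℕ-inject₁ (inject₁ (inject₁ i)))
                (trans (toℕ-inject₁ (inject₁ i)) (toℕ-inject₁ i))))) (cong toℕ e))

  module _ {G : Graph n} (c : C → Fin n) (cyc : IsCycle G (5 + k) c) where

    record Chord (i j : C) : Set where
      constructor chord
      field
        distinct : i ≢ j
        ¬next    : i ≢ prev j
        ¬prev    : j ≢ prev i
        edge     : Edge G (c i) (c j)

    TwoChords : Set
    TwoChords = ∃[ a ] ∃[ b ] ∃[ a' ] ∃[ b' ]
      (IsChord G (5 + k) c a b × IsChord G (5 + k) c a' b' × ¬ ((a ≡ a') × (b ≡ b')))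

    orient : ∀ {i j} → Chord i j →
      ∃[ a ] ∃[ b ] (IsChord G (5 + k) c a b × ((a ≡ i × b ≡ j) ⊎ (a ≡ j × b ≡ i)))
    orient {i} {j} (chord d ¬n ¬p e) with <-cmp i j
    ... | tri< i<j _ _ = i , j , (i<j , ¬n ∘ CycNext⇒prev , ¬p ∘ CycNext⇒prev , e) , inj₁ (refl , refl)
    ... | tri≈ _ i≡j _ = ⊥-elim (d i≡j)
    ... | tri> _ _ j<i = j , i , (j<i , ¬p ∘ CycNext⇒prev , ¬n ∘ CycNext⇒prev ,
                           E-flip (adj-sym G) e) , inj₂ (refl , refl)

    twoChords : ∀ {i j i′ j′} → Chord i j → Chord i′ j′ →
      ¬ (i ≡ i′ × j ≡ j′) → ¬ (i ≡ j′ × j ≡ i′) → TwoChords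
    twoChords χ χ′ ≢₁ ≢₂ with orient χ | orient χ′
    ... | a , b , ch , o | a′ , b′ , ch′ , o′ = a , b , a′ , b′ , ch , ch′ , λ (e , e′) → differ e e′ o o′
      where
      differ : a ≡ a′ → b ≡ b′ → _ ⊎ _ → _ ⊎ _ → ⊥
      differ refl refl (inj₁ (refl , refl)) (inj₁ (p , q)) = ≢₁ (p , q)
      differ refl refl (inj₁ (refl , refl)) (inj₂ (p , q)) = ≢₂ (p , q)
      differ refl refl (inj₂ (refl , refl)) (inj₁ (p , q)) = ≢₂ (q , p)
      differ refl refl (inj₂ (refl , refl)) (inj₂ (p , q)) = ≢₁ (q , p)

    chord² : ∀ i → Edge G (c (prev² i)) (c i) → Chord (prev² i) i
    chord² i = chord (prev²-≢ i) (prev-≢ (prev i)) (≢-sym (prev³-≢ i))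

    chord³ : ∀ i → Edge G (c (prev³ i)) (c i) → Chord (prev³ i) i
    chord³ i = chord (prev³-≢ i) (prev²-≢ (prev i)) (≢-sym (prev⁴-≢ i))

    onCycle? : ∀ x → Dec (∃[ i ] c i ≡ x)
    onCycle? x = any? λ i → c i ≟ x

    cycleSet : Subset n
    cycleSet = subset onCycle?

    c∈ : ∀ i → c i ∈ cycleSet
    c∈ i = ∈-subset⁺ onCycle? (i , refl)

    cycle-edge : ∀ i → Edge G (c (prev i)) (c i)
    cycle-edge i = proj₂ cyc _ _ (prev-CycNext i)

    -- The two windows of four consecutive vertices with prev² i as a midpoint each carry a chord;
    -- a chord lying in both windows joins the two neighbours of prev² i.
    nonMid⇒chord : ∀ i → NonMid (adj G) cycleSet (c (prev² i)) →
      TwoChords ⊎ Chord (prev³ i) (prev i)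
    nonMid⇒chord i nm with adj G (c (prev³ i)) (c (prev i)) in bd
    ... | true = inj₂ (chord² (prev i) bd)
    ... | false = inj₁ (combine later earlier)
      where
      later : Chord (prev² i) i ⊎ Chord (prev³ i) i
      later with adj G (c (prev² i)) (c i) in ce | adj G (c (prev³ i)) (c i) in be
      ... | true  | _ = inj₁ (chord² i ce)
      ... | false | true = inj₂ (chord³ i be)
      ... | false | false = ⊥-elim (nm (c∈ _) (c∈ _) (c∈ _)
            (p4 (cycle-edge (prev² i)) (cycle-edge (prev i)) (cycle-edge i) bd ce be))
      earlier : Chord (prev⁴ i) (prev² i) ⊎ Chord (prev⁴ i) (prev i)
      earlier with adj G (c (prev⁴ i)) (c (prev² i)) in ac | adj G (c (prev⁴ i)) (c (prev i)) in ad
      ... | true  | _ = inj₁ (chord² (prev² i) ac)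
      ... | false | true = inj₂ (chord³ (prev i) ad)
      ... | false | false = ⊥-elim (nm (c∈ _) (c∈ _) (c∈ _)
            (P4-reverse (adj-sym G) (p4 (cycle-edge (prev³ i)) (cycle-edge (prev² i)) (cycle-edge (prev i)) ac bd ad)))
      combine : Chord (prev² i) i ⊎ Chord (prev³ i) i →
        Chord (prev⁴ i) (prev² i) ⊎ Chord (prev⁴ i) (prev i) → TwoChords
      combine (inj₁ x) (inj₁ y) = twoChords x y (λ (_ , e) → prev²-≢ i (sym e)) (λ (_ , e) → prev⁴-≢ i (sym e))
      combine (inj₁ x) (inj₂ y) = twoChords x y (λ (_ , e) → prev-≢ i (sym e)) (λ (_ , e) → prev⁴-≢ i (sym e))
      combine (inj₂ x) (inj₁ y) = twoChords x y (λ (_ , e) → prev²-≢ i (sym e)) (λ (_ , e) → prev⁴-≢ i (sym e))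
      combine (inj₂ x) (inj₂ y) = twoChords x y (λ (_ , e) → prev-≢ i (sym e)) (λ (_ , e) → prev⁴-≢ i (sym e))

    nonMid-on-cycle : Elim (adj G) cycleSet → ∀ v i → c i ≢ v →
      ∃[ j ] (c (prev² j) ≢ v × (TwoChords ⊎ Chord (prev³ j) (prev j)))
    nonMid-on-cycle el v i ci≢v with el v (c i) (c∈ i) ci≢v
    ... | x , x∈ , x≢v , nm with ∈-subset⁻ onCycle? x∈
    ... | l , refl with next l
    ... | l′ , refl with next l′
    ... | j , refl = j , x≢v , nonMid⇒chord j nm

    -- Two distinct non-midpoints each carry a chord between their neighbours. If these chords
    -- agreed, the vertices between their ends would agree too or, with the ends exchanged, the
    -- cycle would close after four steps.
    cycle⇒twoChords : Elim (adj G) cycleSet → TwoChords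
    cycle⇒twoChords el
      with nonMid-on-cycle el (c zero) (suc zero) (λ e → prev-≢ (suc zero) (sym (proj₁ cyc e)))
    ... | _ , _ , inj₁ two = two
    ... | i , _ , inj₂ χ
      with nonMid-on-cycle el (c (prev² i)) i (λ e → prev²-≢ i (sym (proj₁ cyc e)))
    ... | _ , _ , inj₁ two = two
    ... | j , cj≢ci , inj₂ χ′ = twoChords χ χ′
      (λ (_ , e) → cj≢ci (cong (c ∘ prev) (sym e)))
      (λ (e , e′) → prev⁴-≢ (prev j) (trans (cong prev² (sym e′)) e))

meyniel : (G : Graph n) → (∀ S → Elim (adj G) S) → Meyniel G
meyniel G el j c cyc = cycle⇒twoChords {G = G} c cyc (el _)

-- Counting

count≥1 : ∀ {m} (p : Fin m → Bool) {i} → p i ≡ true → 1 ≤ count p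
count≥1 p {zero} e rewrite e = s≤s z≤n
count≥1 p {suc i} e = ℕ.≤-trans (count≥1 (p ∘ suc) e) (ℕ.m≤n+m _ _)

count≥2 : ∀ {m} (p : Fin m → Bool) {i j} → i ≢ j → p i ≡ true → p j ≡ true → 2 ≤ count p
count≥2 p {zero} {zero} ne _ _ = ⊥-elim (ne refl)
count≥2 p {zero} {suc j} _ e f rewrite e = s≤s (count≥1 (p ∘ suc) f)
count≥2 p {suc i} {zero} _ e f rewrite f = s≤s (count≥1 (p ∘ suc) e)
count≥2 p {suc i} {suc j} ne e f =
  ℕ.≤-trans (count≥2 (p ∘ suc) (ne ∘ cong suc) e f) (ℕ.m≤n+m _ _)

count≥3 : ∀ {m} (p : Fin m → Bool) {i j k} → i ≢ j → i ≢ k → j ≢ k →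
  p i ≡ true → p j ≡ true → p k ≡ true → 3 ≤ count p
count≥3 p {zero} {zero} ij _ _ _ _ _ = ⊥-elim (ij refl)
count≥3 p {zero} {suc j} {zero} _ ik _ _ _ _ = ⊥-elim (ik refl)
count≥3 p {suc i} {zero} {zero} _ _ jk _ _ _ = ⊥-elim (jk refl)
count≥3 p {zero} {suc j} {suc k} _ _ jk e f g rewrite e =
  s≤s (count≥2 (p ∘ suc) (jk ∘ cong suc) f g)
count≥3 p {suc i} {zero} {suc k} _ ik _ e f g rewrite f =
  s≤s (count≥2 (p ∘ suc) (ik ∘ cong suc) e g)
count≥3 p {suc i} {suc j} {zero} ij _ _ e f g rewrite g =
  s≤s (count≥2 (p ∘ suc) (ij ∘ cong suc) e f)
count≥3 p {suc i} {suc j} {suc k} ij ik jk e f g =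
  ℕ.≤-trans (count≥3 (p ∘ suc) (ij ∘ cong suc) (ik ∘ cong suc) (jk ∘ cong suc) e f g) (ℕ.m≤n+m _ _)

count≡0 : ∀ {m} (p : Fin m → Bool) → (∀ i → p i ≡ false) → count p ≡ 0
count≡0 {zero} p _ = refl
count≡0 {suc m} p none rewrite none zero = count≡0 (p ∘ suc) (none ∘ suc)

-- Reachability in acyclic digraphs

module Reach {m : ℕ} (A : Fin m → Fin m → Bool) (acyclic : Acyclic A) where

  infix 4 _⟶_ _⇝_
  _⟶_ _⇝_ : Fin m → Fin m → Set
  _⟶_ = Arc A
  _⇝_ = Ancestor A

  private variable u v w : Fin m

  arc? : ∀ u v → Dec (u ⟶ v)
  arc? u v = A u v Bool.≟ true

  private
    ⟶⁺ : u ⟶ v → v ⇝ w → TransClosure _⟶_ u w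
    ⟶⁺ a ε = [ a ]
    ⟶⁺ a (b ◅ p) = a ∷ ⟶⁺ b p

    -- Acyclicity in the form that, on a finite set, yields well-founded induction along arcs in
    -- both directions.
    ⟶⁺-isSPO : IsStrictPartialOrder _≡_ (TransClosure _⟶_)
    ⟶⁺-isSPO = record
      { isEquivalence = isEquivalence
      ; irrefl = λ { refl c → acyclic _ c }
      ; trans = Plus._++_
      ; <-resp-≈ = (λ { refl p → p }) , (λ { refl p → p }) }

  no-cycle : u ⟶ v → ¬ v ⇝ u
  no-cycle a p = acyclic _ (⟶⁺ a p)

  ⇝-antisym : u ⇝ v → v ⇝ u → u ≡ v
  ⇝-antisym ε _ = refl
  ⇝-antisym (a ◅ p) q = ⊥-elim (no-cycle a (p ◅◅ q))

  unsnoc : u ⇝ v → u ≡ v ⊎ ∃[ p ] (u ⇝ p × p ⟶ v)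
  unsnoc ε = inj₁ refl
  unsnoc (a ◅ p) with unsnoc p
  ... | inj₁ refl = inj₂ (_ , ε , a)
  ... | inj₂ (q , r , b) = inj₂ (q , a ◅ r , b)

  reach? : ∀ u v → Dec (u ⇝ v)
  reach? u v = go v (spo-wellFounded ⟶⁺-isSPO v)
    where
    go : ∀ v → Acc (TransClosure _⟶_) v → Dec (u ⇝ v)
    go v (acc rs) with u ≟ v
    ... | yes refl = yes ε
    ... | no u≢v = map′ (λ { (p , a , q) → q ◅◅ (a ◅ ε) }) back (any? through)
      where
      through : ∀ p → Dec (p ⟶ v × u ⇝ p)
      through p with arc? p v
      ... | no ¬a = no (¬a ∘ proj₁)
      ... | yes a = map′ (a ,_) proj₂ (go p (rs [ a ]))
      back : u ⇝ v → ∃[ p ] (p ⟶ v × u ⇝ p)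
      back r with unsnoc r
      ... | inj₁ e = ⊥-elim (u≢v e)
      ... | inj₂ (p , q , a) = p , a , q

  descend : {P : Fin m → Set} → (∀ z → Dec (P z)) → P w →
    ∃[ z ] (w ⇝ z × P z × (∀ {c} → z ⟶ c → ¬ P c))
  descend {w} {P} P? pw = go w (spo-noetherian ⟶⁺-isSPO w) pw
    where
    go : ∀ w → Acc (flip (TransClosure _⟶_)) w → P w →
      ∃[ z ] (w ⇝ z × P z × (∀ {c} → z ⟶ c → ¬ P c))
    go w (acc rs) pw with any? (λ c → arc? w c ×-dec P? c)
    ... | no none = w , ε , pw , λ a pc → none (_ , a , pc)
    ... | yes (c , a , pc) with go c (rs [ a ]) pc
    ... | z , p , r = z , a ◅ p , r

  source-reaches : (r : Fin m) → (∀ v → v ≢ r → ∃[ p ] p ⟶ v) → ∀ v → r ⇝ v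
  source-reaches r parent v = go v (spo-wellFounded ⟶⁺-isSPO v)
    where
    go : ∀ v → Acc (TransClosure _⟶_) v → r ⇝ v
    go v (acc rs) with v ≟ r
    ... | yes refl = ε
    ... | no v≢r with parent v v≢r
    ... | p , a = go p (rs [ a ]) ◅◅ (a ◅ ε)

-- Biconnected sets

module Blocks {m : ℕ} (A : Fin m → Fin m → Bool) where

  open ListMembership (_≟_ {m}) using () renaming (_∈_ to _∈ₗ_; _∉_ to _∉ₗ_; _∈?_ to _∈ₗ?_)

  private variable
    r s s′ t t′ u v : Fin m
    L L₁ L₂ : List (Fin m)

  UArc : Fin m → Fin m → Set
  UArc u v = Arc A u v ⊎ Arc A v u

  data SimplePath : Fin m → Fin m → List (Fin m) → Set where
    stop : SimplePath x x (x ∷ [])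
    step : UArc x y → SimplePath y z L → x ∉ₗ L → SimplePath x z (x ∷ L)

  start∈ : SimplePath s t L → s ∈ₗ L
  start∈ stop = here refl
  start∈ (step _ _ _) = here refl

  end∈ : SimplePath s t L → t ∈ₗ L
  end∈ stop = here refl
  end∈ (step _ p _) = there (end∈ p)

  suffix : SimplePath s t L → x ∈ₗ L → ∃[ L′ ] (SimplePath x t L′ × (∀ {z} → z ∈ₗ L′ → z ∈ₗ L))
  suffix stop (here refl) = _ , stop , id
  suffix (step a p x∉) (here refl) = _ , step a p x∉ , id
  suffix (step a p x∉) (there i) with suffix p i
  ... | _ , q , sub = _ , q , there ∘ sub

  Within : (Fin m → Set) → Fin m → Fin m → Set
  Within P x y = UArc x y × P x × P y

  Within-sym : ∀ {P} → Within P x y → Within P y x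
  Within-sym (a , p , q) = swap a , q , p

  shortcut : ∀ {P} → P t → Star (Within P) s t →
    ∃[ L ] (SimplePath s t L × (∀ {z} → z ∈ₗ L → P z))
  shortcut pt ε = _ , stop , λ { (here refl) → pt }
  shortcut {s = s} pt ((a , ps , _) ◅ p) with shortcut pt p
  ... | L , q , inP with s ∈ₗ? L
  ... | no s∉L = _ , step a q s∉L , λ { (here refl) → ps ; (there i) → inP i }
  ... | yes s∈L with suffix q s∈L
  ... | _ , q′ , sub = _ , q′ , inP ∘ sub

  toEnd : {R : Fin m → Fin m → Set} → (∀ {x y} → x ∈ₗ L → y ∈ₗ L → UArc x y → R x y) →
    SimplePath s t L → z ∈ₗ L → Star R z t
  toEnd f stop (here refl) = ε
  toEnd f (step a p _) (here refl) =
    f (here refl) (there (start∈ p)) a ◅ toEnd (λ i j → f (there i) (there j)) p (start∈ p)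
  toEnd f (step a p _) (there i) = toEnd (λ i j → f (there i) (there j)) p i

  -- Removing `r` splits a simple path into at most two pieces, each retaining an end of the path.
  toSomeEnd : {R : Fin m → Fin m → Set} →
    (∀ {x y} → x ∈ₗ L → y ∈ₗ L → x ≢ r → y ≢ r → UArc x y → R x y) →
    SimplePath s t L → z ∈ₗ L → z ≢ r → (Star R z s × s ≢ r) ⊎ (Star R z t × t ≢ r)
  toSomeEnd f stop (here refl) z≢r = inj₁ (ε , z≢r)
  toSomeEnd f (step a p _) (here refl) z≢r = inj₁ (ε , z≢r)
  toSomeEnd {r = r} {s = s} f (step a p s∉) (there i) z≢r
    with toSomeEnd (λ i j → f (there i) (there j)) p i z≢r
  ... | inj₂ q = inj₂ q
  ... | inj₁ (q , y≢r) with s ≟ r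
  ... | no s≢r = inj₁ (q ◅◅ (f (there (start∈ p)) (here refl) y≢r s≢r (swap a) ◅ ε) , s≢r)
  ... | yes refl = inj₂ (toEnd (λ i j → f (there i) (there j) (off i) (off j)) p i , off (end∈ p))
    where
    off : ∀ {x} → x ∈ₗ _ → x ≢ s
    off i refl = s∉ i

  UAdjIn-sym : ∀ {B} → UAdjIn A B x y → UAdjIn A B y x
  UAdjIn-sym (p , q , a) = q , p , swap a

  UAdjAvoid-sym : ∀ {B} → UAdjAvoid A B r x y → UAdjAvoid A B r y x
  UAdjAvoid-sym (p , q , a) = q , p , UAdjIn-sym a

  meetAt : {R : Fin m → Fin m → Set} → (∀ {x y} → R x y → R y x) →
    Star R x z → Star R y z → Star R x y
  meetAt R-sym p q = p ◅◅ reverse R-sym q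

  onEither? : ∀ L₁ L₂ z → Dec (z ∈ₗ L₁ ⊎ z ∈ₗ L₂)
  onEither? L₁ L₂ z = (z ∈ₗ? L₁) ⊎-dec (z ∈ₗ? L₂)

  -- With `r` off the second path, that path stays intact as a hub: what remains of the first
  -- reaches one of its own ends and crosses over there.
  around : {R : Fin m → Fin m → Set} → SimplePath s t L₁ → SimplePath s′ t′ L₂ →
    UArc t s′ → UArc s t′ →
    (∀ {x y} → x ∈ₗ L₁ ⊎ x ∈ₗ L₂ → y ∈ₗ L₁ ⊎ y ∈ₗ L₂ → x ≢ r → y ≢ r → UArc x y → R x y) →
    r ∉ₗ L₂ → z ∈ₗ L₁ ⊎ z ∈ₗ L₂ → z ≢ r → Star R z t′
  around {L₂ = L₂} {r = r} {R = R} p q a b f r∉ = go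
    where
    off : ∀ {x} → x ∈ₗ L₂ → x ≢ r
    off i refl = r∉ i
    along : ∀ {z} → z ∈ₗ L₂ → Star R z _
    along = toEnd (λ i j → f (inj₂ i) (inj₂ j) (off i) (off j)) q
    go : ∀ {z} → z ∈ₗ _ ⊎ z ∈ₗ L₂ → z ≢ r → Star R z _
    go (inj₂ i) _ = along i
    go (inj₁ i) z≢r with toSomeEnd (λ i j → f (inj₁ i) (inj₁ j)) p i z≢r
    ... | inj₁ (c , s≢r) =
      c ◅◅ (f (inj₁ (start∈ p)) (inj₂ (end∈ q)) s≢r (off (end∈ q)) b ◅ ε)
    ... | inj₂ (c , t≢r) =
      c ◅◅ (f (inj₁ (end∈ p)) (inj₂ (start∈ q)) t≢r (off (start∈ q)) a ◅ along (start∈ q))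

  -- A cycle is given as two disjoint paths joined at their ends. A deleted vertex misses at least
  -- one of them, and the intact one keeps everything connected.
  cycle-biconnected : SimplePath s t L₁ → SimplePath s′ t′ L₂ →
    (∀ {z} → z ∈ₗ L₁ → z ∉ₗ L₂) → UArc t s′ → UArc s t′ →
    Biconnected A (subset (onEither? L₁ L₂))
  cycle-biconnected {s} {t} {L₁} {s′} {t′} {L₂} p q disjoint a b =
    (s , s′ , (λ { refl → disjoint (start∈ p) (start∈ q) }) ,
      inB (inj₁ (start∈ p)) , inB (inj₂ (start∈ q))) ,
    (λ u v u∈ v∈ → meetAt UAdjIn-sym (conn (out u∈)) (conn (out v∈))) ,
    avoid
    where
    B : Subset m
    B = subset (onEither? L₁ L₂)
    inB : ∀ {z} → z ∈ₗ L₁ ⊎ z ∈ₗ L₂ → z ∈ B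
    inB = ∈-subset⁺ (onEither? L₁ L₂)
    out : ∀ {z} → z ∈ B → z ∈ₗ L₁ ⊎ z ∈ₗ L₂
    out = ∈-subset⁻ (onEither? L₁ L₂)
    conn : ∀ {z} → z ∈ₗ L₁ ⊎ z ∈ₗ L₂ → Star (UAdjIn A B) z t′
    conn (inj₂ i) = toEnd (λ i j c → inB (inj₂ i) , inB (inj₂ j) , c) q i
    conn (inj₁ i) = toEnd (λ i j c → inB (inj₁ i) , inB (inj₁ j) , c) p i ◅◅
      ((inB (inj₁ (end∈ p)) , inB (inj₂ (start∈ q)) , a) ◅ conn (inj₂ (start∈ q)))
    avoid : ∀ r → r ∈ B → ∀ u v → u ∈ B → v ∈ B → u ≢ r → v ≢ r → Star (UAdjAvoid A B r) u v
    avoid r r∈ u v u∈ v∈ u≢r v≢r with r ∈ₗ? L₂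
    ... | no r∉L₂ = meetAt UAdjAvoid-sym (go (out u∈) u≢r) (go (out v∈) v≢r)
      where go = λ {z} → around {z = z} p q a b (λ i j k l c → k , l , inB i , inB j , c) r∉L₂
    ... | yes r∈L₂ = meetAt UAdjAvoid-sym (go (swap (out u∈)) u≢r) (go (swap (out v∈)) v≢r)
      where go = λ {z} → around {z = z} q p (swap b) (swap a)
                   (λ i j k l c → k , l , inB (swap i) , inB (swap j) , c) (λ i → disjoint i r∈L₂)

  module _ {B C : Subset m} (biB : Biconnected A B) (biC : Biconnected A C) where

    private
      liftIn : ∀ {D D′} → (∀ {z} → z ∈ D → z ∈ D′) → UAdjIn A D x y → UAdjIn A D′ x y
      liftIn sub (p , q , a) = sub p , sub q , a

      inB : x ∈ B → x ∈ B ∪ C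
      inB = x∈p∪q⁺ ∘ inj₁

      inC : x ∈ C → x ∈ B ∪ C
      inC = x∈p∪q⁺ ∘ inj₂

      avoidVia : ∀ {D} → Biconnected A D → (∀ {z} → z ∈ D → z ∈ B ∪ C) → ∀ r →
        u ∈ D → v ∈ D → u ≢ r → v ≢ r → Star (UAdjAvoid A (B ∪ C) r) u v
      avoidVia {D = D} (_ , conn , avoid) sub r u∈ v∈ u≢r v≢r with r ∈? D
      ... | yes r∈ = gmap id (λ (p , q , a) → p , q , liftIn sub a) (avoid r r∈ _ _ u∈ v∈ u≢r v≢r)
      ... | no r∉ = gmap id (λ (p , q , a) → off p , off q , liftIn sub (p , q , a)) (conn _ _ u∈ v∈)
        where
        off : ∀ {x} → x ∈ D → x ≢ r
        off p refl = r∉ p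

    -- Deleting one vertex leaves `x` or `y`, and every remaining vertex reaches that survivor
    -- within its own set.
    ∪-biconnected : x ≢ y → x ∈ B → x ∈ C → y ∈ B → y ∈ C → Biconnected A (B ∪ C)
    ∪-biconnected {x} {y} x≢y xB xC yB yC =
      (x , y , x≢y , inB xB , inB yB) ,
      (λ u v u∈ v∈ → meetAt UAdjIn-sym (toX (x∈p∪q⁻ B C u∈)) (toX (x∈p∪q⁻ B C v∈))) ,
      λ r _ u v u∈ v∈ u≢r v≢r → avoid r u≢r v≢r (x∈p∪q⁻ B C u∈) (x∈p∪q⁻ B C v∈)
      where
      toX : ∀ {z} → z ∈ B ⊎ z ∈ C → Star (UAdjIn A (B ∪ C)) z x
      toX (inj₁ p) = gmap id (liftIn inB) (proj₁ (proj₂ biB) _ _ p xB)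
      toX (inj₂ p) = gmap id (liftIn inC) (proj₁ (proj₂ biC) _ _ p xC)
      toAnchor : ∀ {r w z} → w ∈ B → w ∈ C → w ≢ r → z ≢ r → z ∈ B ⊎ z ∈ C →
        Star (UAdjAvoid A (B ∪ C) r) z w
      toAnchor wB wC w≢r z≢r (inj₁ p) = avoidVia biB inB _ p wB z≢r w≢r
      toAnchor wB wC w≢r z≢r (inj₂ p) = avoidVia biC inC _ p wC z≢r w≢r
      avoid : ∀ r {u v} → u ≢ r → v ≢ r → u ∈ B ⊎ u ∈ C → v ∈ B ⊎ v ∈ C →
        Star (UAdjAvoid A (B ∪ C) r) u v
      avoid r u≢r v≢r u∈ v∈ with x ≟ r
      ... | no x≢r = meetAt UAdjAvoid-sym (toAnchor xB xC x≢r u≢r u∈) (toAnchor xB xC x≢r v≢r v∈)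
      ... | yes refl = meetAt UAdjAvoid-sym (toAnchor yB yC (≢-sym x≢y) u≢r u∈)
                         (toAnchor yB yC (≢-sym x≢y) v≢r v∈)

  AtMostOneHybrid : Set
  AtMostOneHybrid = ∀ C → BiconnectedComponent A C →
    ∀ v w → HybridWithParentsIn A C v → HybridWithParentsIn A C w → v ≡ w

  hybrid-mono : ∀ {B C} → (∀ {z} → z ∈ B → z ∈ C) →
    HybridWithParentsIn A B v → HybridWithParentsIn A C v
  hybrid-mono sub (e , f) = e , λ u a → sub (f u a)

  -- (N4) concerns maximal biconnected sets. By induction over larger sets, two different hybrids in
  -- `B` leave it no biconnected proper superset, so `B` would be a component itself.
  biconnected-unique : AtMostOneHybrid → ∀ B → Biconnected A B →
    HybridWithParentsIn A B v → HybridWithParentsIn A B u → v ≡ u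
  biconnected-unique {v} {u} galled B = go B (⊃-wellFounded B)
    where
    go : ∀ B → Acc _⊃_ B → Biconnected A B →
      HybridWithParentsIn A B v → HybridWithParentsIn A B u → v ≡ u
    go B (acc rs) bi hv hu with v ≟ u
    ... | yes e = e
    ... | no v≢u = galled B (bi , maximal) v u hv hu
      where
      maximal : ∀ C → B ⊆ C → Biconnected A C → C ⊆ B
      maximal C B⊆C biC {x} x∈C with x ∈? B
      ... | yes x∈B = x∈B
      ... | no x∉B = ⊥-elim (v≢u (go C (rs (B⊆C , x , x∈C , x∉B)) biC
                       (hybrid-mono B⊆C hv) (hybrid-mono B⊆C hu)))

-- Arcs entering the descendants of a vertex

module Galls {m : ℕ} (A : Fin m → Fin m → Bool) (acyclic : Acyclic A)
             (root : Fin m) (root⇝ : ∀ v → Ancestor A root v)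
             (indeg≤2 : ∀ v → indeg A v ≤ 2)
             (galled : Blocks.AtMostOneHybrid A) where

  open Reach A acyclic
  open Blocks A
  open ListMembership (_≟_ {m}) using () renaming (_∈_ to _∈ₗ_; _∉_ to _∉ₗ_)

  private variable
    c h h′ p p′ u v v′ w : Fin m

  third-parent : p ≢ p′ → p ⟶ h → p′ ⟶ h → u ⟶ h → u ≡ p ⊎ u ≡ p′
  third-parent {p} {p′} {h} {u} p≢p′ a a′ b with u ≟ p | u ≟ p′
  ... | yes e | _ = inj₁ e
  ... | no _ | yes e = inj₂ e
  ... | no u≢p | no u≢p′ =
    ⊥-elim (ℕ.<⇒≱ (count≥3 (λ z → A z h) u≢p u≢p′ p≢p′ b a a′) (indeg≤2 h))

  hybrid-in : ∀ {B} → p ≢ p′ → p ⟶ h → p′ ⟶ h → p ∈ B → p′ ∈ B → HybridWithParentsIn A B h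
  hybrid-in {p} {p′} {h} {B} p≢p′ a a′ i i′ =
    ℕ.≤-antisym (indeg≤2 h) (count≥2 (λ z → A z h) p≢p′ a a′) , λ u b → inB (third-parent p≢p′ a a′ b)
    where
    inB : ∀ {u} → u ≡ p ⊎ u ≡ p′ → u ∈ B
    inB (inj₁ refl) = i
    inB (inj₂ refl) = i′

  -- The arcs by which a path can get below `w` without passing through `w`.
  record Entry (w p h : Fin m) : Set where
    constructor entry
    field
      outside : ¬ w ⇝ p
      below   : w ⇝ h
      strict  : w ≢ h
      arc     : p ⟶ h

  entry? : ∀ w p h → Dec (Entry w p h)
  entry? w p h = map′ (λ (a , b , c , d) → entry a b c d) (λ (entry a b c d) → a , b , c , d)
    (¬? (reach? w p) ×-dec reach? w h ×-dec ¬? (w ≟ h) ×-dec arc? p h)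

  other-parent : Entry w p h → ∃[ p′ ] (w ⇝ p′ × p′ ⟶ h)
  other-parent e with unsnoc (Entry.below e)
  ... | inj₁ w≡h = ⊥-elim (Entry.strict e w≡h)
  ... | inj₂ r = r

  directed : {P : Fin m → Set} → (∀ {z} → u ⇝ z → z ⇝ v → P z) → u ⇝ v → Star (Within P) u v
  directed f ε = ε
  directed f (a ◅ p) = (inj₁ a , f ε (a ◅ p) , f (a ◅ ε) p) ◅ directed (λ q → f (a ◅ q)) p

  -- No ancestor of a non-descendant of `w` is a descendant of `w`, so climbing from `v` to the root
  -- and descending to `p` stays outside.
  path-above : ¬ w ⇝ v → ¬ w ⇝ p → ∃[ L ] (SimplePath v p L × (∀ {z} → z ∈ₗ L → ¬ w ⇝ z))
  path-above ¬v ¬p = shortcut ¬p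
    (reverse Within-sym (directed (λ _ z⇝v w⇝z → ¬v (w⇝z ◅◅ z⇝v)) (root⇝ _)) ◅◅
     directed (λ _ z⇝p w⇝z → ¬p (w⇝z ◅◅ z⇝p)) (root⇝ _))

  -- The cycle runs from `h` through its other parent up to `w`, over the arc to `v`, outside the
  -- descendants of `w` to `p`, and back. Its halves are disjoint because only the first lies below
  -- `w`.
  entry-cycle : v ⟶ w → Entry w p h →
    ∃[ B ] (Biconnected A B × v ∈ B × w ∈ B × HybridWithParentsIn A B h)
  entry-cycle {v} {w} {p} {h} a e@(entry out _ _ arc)
    with other-parent e | path-above (no-cycle a) out
  ... | p′ , w⇝p′ , a′ | L₂ , q₂ , above
    with shortcut {P = λ z → w ⇝ z × z ⇝ p′} (ε , w⇝p′)
           (reverse Within-sym (directed (λ r s → r , s) w⇝p′))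
  ... | L₁ , q₁ , between =
    _ , cycle-biconnected (step (inj₂ a′) q₁ h∉) q₂ disjoint (inj₂ a) (inj₂ arc) ,
    inB (inj₂ (start∈ q₂)) , inB (inj₁ (there (end∈ q₁))) ,
    hybrid-in (λ { refl → out w⇝p′ }) arc a′ (inB (inj₂ (end∈ q₂))) (inB (inj₁ (there (start∈ q₁))))
    where
    inB : ∀ {z} → z ∈ₗ h ∷ L₁ ⊎ z ∈ₗ L₂ → z ∈ subset (onEither? (h ∷ L₁) L₂)
    inB = ∈-subset⁺ (onEither? (h ∷ L₁) L₂)
    h∉ : h ∉ₗ L₁
    h∉ i = no-cycle a′ (proj₂ (between i))
    disjoint : ∀ {z} → z ∈ₗ h ∷ L₁ → z ∉ₗ L₂
    disjoint (here refl) j = above j (w⇝p′ ◅◅ (a′ ◅ ε))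
    disjoint (there i) j = above j (proj₁ (between i))

  hybrid-cycle : v ⟶ w → v′ ⟶ w → v ≢ v′ →
    ∃[ B ] (Biconnected A B × v ∈ B × w ∈ B × HybridWithParentsIn A B w)
  hybrid-cycle {v} {w} {v′} a a′ v≢v′ with path-above (no-cycle a) (no-cycle a′)
  ... | L , q , above =
    _ , cycle-biconnected stop q (λ { (here refl) j → above j ε }) (inj₂ a) (inj₂ a′) ,
    inB (inj₂ (start∈ q)) , inB (inj₁ (here refl)) ,
    hybrid-in v≢v′ a a′ (inB (inj₂ (start∈ q))) (inB (inj₂ (end∈ q)))
    where
    inB : ∀ {z} → z ∈ₗ w ∷ [] ⊎ z ∈ₗ L → z ∈ subset (onEither? (w ∷ []) L)
    inB = ∈-subset⁺ (onEither? (w ∷ []) L)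

  share-arc : ∀ {B C} → v ⟶ w → Biconnected A B × v ∈ B × w ∈ B × HybridWithParentsIn A B h →
    Biconnected A C × v ∈ C × w ∈ C × HybridWithParentsIn A C h′ → h ≡ h′
  share-arc {B = B} {C} a (biB , vB , wB , hB) (biC , vC , wC , hC) =
    biconnected-unique galled (B ∪ C)
      (∪-biconnected biB biC (λ { refl → no-cycle a ε }) vB vC wB wC)
      (hybrid-mono (x∈p∪q⁺ ∘ inj₁) hB) (hybrid-mono (x∈p∪q⁺ ∘ inj₂) hC)

  -- Two parents would make `w` a hybrid on a cycle through `v ⟶ w`, an arc that the cycle of the
  -- entry also uses; uniqueness would then give `w ≡ h`.
  entered-tree : Entry w p h → v ⟶ w → v′ ⟶ w → v ≡ v′
  entered-tree {v = v} {v′} e a a′ with v ≟ v′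
  ... | yes eq = eq
  ... | no v≢v′ =
    ⊥-elim (Entry.strict e (share-arc a (proj₂ (hybrid-cycle a a′ v≢v′)) (proj₂ (entry-cycle a e))))

  -- Both cycles use the arc above `w`, so the hybrids coincide. Besides `p` and `p′`, that hybrid
  -- has a parent below `w`, and indegree at most two rules out three.
  entry-unique : Entry w p h → Entry w p′ h′ → p ≡ p′ × h ≡ h′
  entry-unique {w} {p} {h} {p′} e e′ with unsnoc (root⇝ w)
  ... | inj₁ refl = ⊥-elim (Entry.outside e (root⇝ _))
  ... | inj₂ (v , _ , a) with share-arc a (proj₂ (entry-cycle a e)) (proj₂ (entry-cycle a e′))
  ... | refl with p ≟ p′ | other-parent e
  ...   | yes eq | _ = eq , refl
  ...   | no p≢p′ | (q , w⇝q , b) with third-parent p≢p′ (Entry.arc e) (Entry.arc e′) b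
  ...     | inj₁ refl = ⊥-elim (Entry.outside e w⇝q)
  ...     | inj₂ refl = ⊥-elim (Entry.outside e′ w⇝q)

  hybrid-clean : v ⟶ h → v′ ⟶ h → v ≢ v′ → ¬ Entry h p z
  hybrid-clean a a′ v≢v′ e = v≢v′ (entered-tree e a a′)

  -- The first arc into the descendants of `w` ends either at `w` or strictly below it, and in the
  -- latter case it is an entry.
  enter : ¬ w ⇝ u → w ⇝ y → u ⇝ y →
    (∃[ v ] (u ⇝ v × v ⟶ w)) ⊎ (∃[ p ] ∃[ h ] (Entry w p h × u ⇝ p × h ⇝ y))
  enter ¬wu wy ε = ⊥-elim (¬wu wy)
  enter {w} {u} ¬wu wy (_◅_ {j = x} a r) with reach? w x
  ... | no ¬wx with enter ¬wx wy r
  ...   | inj₁ (v , q , b) = inj₁ (v , a ◅ q , b)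
  ...   | inj₂ (p , h , e , q , s) = inj₂ (p , h , e , a ◅ q , s)
  enter {w} {u} ¬wu wy (_◅_ {j = x} a r) | yes wx with w ≟ x
  ...   | yes refl = inj₁ (u , ε , a)
  ...   | no w≢x = inj₂ (u , x , entry ¬wu wx w≢x a , ε , r)

  enter-tree : Entry w p h → v ⟶ w → ¬ w ⇝ u → w ⇝ y → u ⇝ y → u ⇝ v ⊎ (u ⇝ p × h ⇝ y)
  enter-tree e a ¬wu wy r with enter ¬wu wy r
  ... | inj₁ (_ , q , b) with refl ← entered-tree e a b = inj₁ q
  ... | inj₂ (_ , _ , e′ , q , s) with refl , refl ← entry-unique e e′ = inj₂ (q , s)

  enter-clean : (∀ {p h} → ¬ Entry w p h) → ¬ w ⇝ u → w ⇝ y → u ⇝ y → ∃[ v ] (u ⇝ v × v ⟶ w)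
  enter-clean clean ¬wu wy r with enter ¬wu wy r
  ... | inj₁ q = q
  ... | inj₂ (_ , _ , e , _) = ⊥-elim (clean e)

-- Neither a P4 nor its complement has a disconnecting cut.
P4-uniform-cut : {E : V → V → Bool} → (∀ x y → E x y ≡ E y x) →
  (R : V → Set) (χ : V → Bool) (ρ : Bool) →
  (∀ {x y} → R x → R y → χ x ≡ true → χ y ≡ false → E x y ≡ ρ) →
  ∀ {a b c d} → P4 E a b c d → R a → R b → R c → R d →
  χ a ≡ χ b × χ a ≡ χ c × χ a ≡ χ d
P4-uniform-cut {E = E} E-sym R χ ρ across {a} {b} {c} {d} p ra rb rc rd = go ρ refl
  where
  same : ∀ {x y} → R x → R y → E x y ≡ not ρ → χ x ≡ χ y
  same {x} {y} rx ry e with χ x in χx | χ y in χy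
  ... | true  | true  = refl
  ... | false | false = refl
  ... | true  | false = ⊥-elim (not-¬ (across rx ry χx χy) e)
  ... | false | true  = ⊥-elim (not-¬ (across ry rx χy χx) (E-flip E-sym e))
  go : ∀ r → r ≡ ρ → χ a ≡ χ b × χ a ≡ χ c × χ a ≡ χ d
  go false refl = let ab = same ra rb (P4.ab p) ; ac = trans ab (same rb rc (P4.bc p)) in
    ab , ac , trans ac (same rc rd (P4.cd p))
  go true refl = let ad = same ra rd (P4.ad p) in
    trans ad (sym (same rb rd (P4.bd p))) , same ra rc (P4.ac p) , ad

-- Leaves of a galled-tree and the graph they explain

≡-from-⇔ : ∀ {b c} → (b ≡ true → c ≡ true) → (c ≡ true → b ≡ true) → b ≡ c
≡-from-⇔ {true}  {true}  _ _ = refl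
≡-from-⇔ {false} {false} _ _ = refl
≡-from-⇔ {true}  {false} f _ = sym (f refl)
≡-from-⇔ {false} {true}  _ g = g refl

isOne : Label → Bool
isOne lab0 = false
isOne lab1 = true
isOne odot = false

module Explained {n m : ℕ} (A : Fin m → Fin m → Bool) (acyclic : Acyclic A)
                 (root : Fin m) (root⇝ : ∀ v → Ancestor A root v)
                 (indeg≤2 : ∀ v → indeg A v ≤ 2)
                 (galled : Blocks.AtMostOneHybrid A)
                 (G : Graph n) (ℓ : Fin n → Fin m) (t : Fin m → Label)
                 (explains : ∀ x y → x ≢ y →
                   Edge G x y ⇔ (∃[ u ] (IsLCA A u (ℓ x) (ℓ y) × t u ≡ lab1))) where

  open Reach A acyclic
  open Galls A acyclic root root⇝ indeg≤2 galled

  infix 4 _≽_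
  _≽_ : Fin m → Fin n → Set
  w ≽ x = w ⇝ ℓ x

  ≽? : ∀ w x → Dec (w ≽ x)
  ≽? w x = reach? w (ℓ x)

  private variable
    c h p p′ u w : Fin m
    y′ : Fin n

  -- If `w` is itself above `x` and `y`, this makes it their least common ancestor. It is also used
  -- with `w` above `y` alone.
  CommonAbove : Fin m → Fin n → Fin n → Set
  CommonAbove w x y = ∀ {u′} → u′ ≽ x → u′ ≽ y → u′ ⇝ w

  adj-least : x ≢ y → u ≽ x → u ≽ y → CommonAbove u x y → adj G x y ≡ isOne (t u)
  adj-least {x} {y} {u} x≢y ux uy least = ≡-from-⇔ to from
    where
    to : Edge G x y → isOne (t u) ≡ true
    to e with Equivalence.to (explains x y x≢y) e
    ... | u′ , ((px , py) , minimal) , tu′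
      with refl ← minimal u ux uy (least px py) rewrite tu′ = refl
    from : isOne (t u) ≡ true → Edge G x y
    from o with t u in tu | o
    ... | lab1 | _ = Equivalence.from (explains x y x≢y)
          (u , ((ux , uy) , λ w wx wy uw → ⇝-antisym (least wx wy) uw) , tu)
    ... | lab0 | ()
    ... | odot | ()

  -- Every common ancestor of either pair lies above `w`, hence above both `y` and `y′`. So the two
  -- pairs have the same common ancestors and the same least one.
  adj-same : x ≢ y → x ≢ y′ → w ≽ y → w ≽ y′ →
    CommonAbove w x y → CommonAbove w x y′ → adj G x y ≡ adj G x y′
  adj-same {x} x≢y x≢y′ wy wy′ f f′ =
    ≡-from-⇔ (transfer x≢y x≢y′ wy wy′ f f′) (transfer x≢y′ x≢y wy′ wy f′ f)
    where
    transfer : ∀ {w y y′} → x ≢ y → x ≢ y′ → w ≽ y → w ≽ y′ →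
      CommonAbove w x y → CommonAbove w x y′ → Edge G x y → Edge G x y′
    transfer ne ne′ wy wy′ f f′ e with Equivalence.to (explains _ _ ne) e
    ... | u , ((ux , uy) , minimal) , tu = Equivalence.from (explains _ _ ne′)
      (u , ((ux , f ux uy ◅◅ wy′) ,
            λ v vx vy′ uv → minimal v vx (f′ vx vy′ ◅◅ wy) uv) , tu)

  module _ {S : Subset n} (prime : Prime (adj G) S) where

    -- `Q` is a module missing `z`, so primality leaves it at most one vertex.
    prime-small : {Q : Fin n → Set} → (∀ x → Dec (Q x)) → (∀ {x} → Q x → x ∈ S) →
      (∀ {x y y′} → x ∈ S → ¬ Q x → Q y → Q y′ → adj G x y ≡ adj G x y′) →
      z ∈ S → ¬ Q z → Q y → Q y′ → y ≡ y′
    prime-small {z = z} {y = y} {y′ = y′} Q? Q⊆S uni z∈S ¬qz qy qy′ with y ≟ y′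
    ... | yes e = e
    ... | no y≢y′ = ⊥-elim (prime (subset Q?)
      (mod (Q⊆S ∘ ∈-subset⁻ Q?) λ _ _ _ sx ¬x y y′ →
        uni sx (¬x ∘ ∈-subset⁺ Q?) (∈-subset⁻ Q? y) (∈-subset⁻ Q? y′))
      ((y , y′ , ∈-subset⁺ Q? qy , ∈-subset⁺ Q? qy′ , y≢y′) , (z , z∈S , ¬qz ∘ ∈-subset⁻ Q?)))

    prime-small-above : {Q : Fin n → Set} → (∀ x → Dec (Q x)) → (∀ {x} → Q x → x ∈ S) →
      (∀ {y} → Q y → w ≽ y) → (∀ {x y} → x ∈ S → ¬ Q x → Q y → CommonAbove w x y) →
      z ∈ S → ¬ Q z → Q y → Q y′ → y ≡ y′
    prime-small-above Q? Q⊆S above f = prime-small Q? Q⊆S λ sx ¬x qy qy′ →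
      adj-same (λ { refl → ¬x qy }) (λ { refl → ¬x qy′ }) (above qy) (above qy′)
        (f sx ¬x qy) (f sx ¬x qy′)

    cluster? : ∀ w x → Dec (x ∈ S × w ≽ x)
    cluster? w x = (x ∈? S) ×-dec ≽? w x

    cluster : Fin m → Subset n
    cluster w = subset (cluster? w)

    clean-small : (∀ {p h} → ¬ Entry w p h) → z ∈ S → ¬ w ≽ z →
      y ∈ S → w ≽ y → y′ ∈ S → w ≽ y′ → y ≡ y′
    clean-small {w} clean z∈S ¬wz sy wy sy′ wy′ =
      prime-small-above (cluster? w) proj₁ proj₂ above z∈S (¬wz ∘ proj₂) (sy , wy) (sy′ , wy′)
      where
      above : ∀ {x y} → x ∈ S → ¬ (x ∈ S × w ≽ x) → y ∈ S × w ≽ y → CommonAbove w x y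
      above sx ¬x (_ , wy) {u′} ux uy
        with enter-clean clean (λ wu → ¬x (sx , wu ◅◅ ux)) wy uy
      ... | _ , q , a = q ◅◅ (a ◅ ε)

    -- One side of a gall whose hybrid vertex h has parents p′ below c and p not below c. The
    -- lowest vertex w on the path from c to p′ above all four vertices would cut them uniformly.
    noP4-below : Entry c p h → c ⇝ p′ → p′ ⟶ h → z ∈ S → ¬ c ≽ z → NoP4 (adj G) (cluster c)
    noP4-below {c} {p} {h} {p′} {z} e@(entry out _ _ arc) c⇝p′ a′ z∈S ¬cz {x₁} {x₂} {x₃} {x₄}
               i₁ i₂ i₃ i₄ P
      with ∈-subset⁻ (cluster? c) i₁ | ∈-subset⁻ (cluster? c) i₂
         | ∈-subset⁻ (cluster? c) i₃ | ∈-subset⁻ (cluster? c) i₄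
    ... | s₁ , c₁ | s₂ , c₂ | s₃ , c₃ | s₄ , c₄
      with descend {P = λ w → w ⇝ p′ × w ≽ x₁ × w ≽ x₂ × w ≽ x₃ × w ≽ x₄}
             (λ w → reach? w p′ ×-dec ≽? w x₁ ×-dec ≽? w x₂ ×-dec ≽? w x₃ ×-dec ≽? w x₄)
             (c⇝p′ , c₁ , c₂ , c₃ , c₄)
    ... | w , c⇝w , (w⇝p′ , w₁ , w₂ , w₃ , w₄) , lowest = analyse w⇝p′
      where
      p≢p′ : p ≢ p′
      p≢p′ refl = out c⇝p′

      entry-w : Entry w p h
      entry-w = entry (out ∘ (c⇝w ◅◅_)) (w⇝p′ ◅◅ (a′ ◅ ε)) (λ { refl → no-cycle a′ w⇝p′ }) arc

      through-w : ∀ {u′ y} → ¬ w ⇝ u′ → w ≽ y → ¬ h ≽ y → u′ ≽ y → u′ ⇝ w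
      through-w ¬wu wy ¬hy uy with enter ¬wu wy uy
      ... | inj₁ (_ , q , a) = q ◅◅ (a ◅ ε)
      ... | inj₂ (_ , _ , e′ , _ , hy) with refl , refl ← entry-unique entry-w e′ = ⊥-elim (¬hy hy)

      -- Here `e′` is the vertex after `w` on the way to `h`: a child of `w` above `p′`, or `h`
      -- itself when `w` is `p′`.
      module AtChild (e′ : Fin m) (e′⇝h : e′ ⇝ h)
                     (enters : ∀ {u′ y} → ¬ e′ ⇝ u′ → e′ ≽ y → u′ ≽ y → u′ ⇝ w ⊎ u′ ⇝ p)
                     (¬all : ¬ (e′ ≽ x₁ × e′ ≽ x₂ × e′ ≽ x₃ × e′ ≽ x₄)) where

        across : ∀ {x y} → w ≽ y → ¬ e′ ≽ y → e′ ≽ x → CommonAbove w x y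
        across wy ¬ey ex {u′} ux uy with enters (λ eu → ¬ey (eu ◅◅ uy)) ex ux
        ... | inj₁ q = q
        -- Such a `u′` is outside the descendants of `w`, because `p` is; it reaches `y`, which is
        -- not below `h`, only through `w`.
        ... | inj₂ up = through-w (λ wu → out (c⇝w ◅◅ wu ◅◅ up)) wy (¬ey ∘ (e′⇝h ◅◅_)) uy

        Rest : Fin n → Set
        Rest x = x ∈ S × w ≽ x × ¬ e′ ≽ x

        rest? : ∀ x → Dec (Rest x)
        rest? x = (x ∈? S) ×-dec ≽? w x ×-dec ¬? (≽? e′ x)

        rest-above : ∀ {x y} → x ∈ S → ¬ Rest x → Rest y → CommonAbove w x y
        rest-above {x} sx ¬x (_ , wy , ¬ey) {u′} ux uy with reach? w u′
        ... | no ¬wu = through-w ¬wu wy (¬ey ∘ (e′⇝h ◅◅_)) uy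
        ... | yes wu with ≽? e′ x
        ...   | no ¬ex = ⊥-elim (¬x (sx , wu ◅◅ ux , ¬ex))
        ...   | yes ex = across wy ¬ey ex ux uy

        rest-small : ∀ {y y′} → Rest y → Rest y′ → y ≡ y′
        rest-small = prime-small-above rest? proj₁ (proj₁ ∘ proj₂) rest-above z∈S
          (λ (_ , wz , _) → ¬cz (c⇝w ◅◅ wz))

        χ : Fin n → Bool
        χ x = does (≽? e′ x)

        χ-true : ∀ {x} → χ x ≡ true → e′ ≽ x
        χ-true = does⁻ (≽? e′ _)

        χ-false : ∀ {x} → χ x ≡ false → ¬ e′ ≽ x
        χ-false χx ex = clash (dec-true (≽? e′ _) ex) χx

        impossible : ⊥
        impossible
          -- `w` is the least common ancestor of every pair that `e′` separates, so the four
          -- vertices fall on one side. Below `e′` contradicts `¬all`; the other side is a module,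
          -- hence has at most one vertex.
          with P4-uniform-cut (adj-sym G) (w ≽_) χ (isOne (t w))
                 (λ wx wy χx χy → adj-least (λ { refl → clash χx χy }) wx wy
                   (across wy (χ-false χy) (χ-true χx)))
                 P w₁ w₂ w₃ w₄
        ... | e₂ , e₃ , e₄ with ≽? e′ x₁
        ...   | yes ex₁ = ¬all (ex₁ , χ-true (sym e₂) , χ-true (sym e₃) , χ-true (sym e₄))
        ...   | no ¬ex₁ = P4-a≢b (adj-sym G) P
                  (rest-small (s₁ , w₁ , ¬ex₁) (s₂ , w₂ , χ-false (sym e₂)))

      analyse : w ⇝ p′ → ⊥
      -- A hybrid-vertex has no entries, so at most one leaf of `S` is below it.
      analyse ε = AtChild.impossible h ε enters
        (λ (h₁ , h₂ , _) → P4-a≢b (adj-sym G) P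
          (clean-small clean z∈S (λ hz → ¬cz (c⇝p′ ◅◅ (a′ ◅ hz))) s₁ h₁ s₂ h₂))
        where
        clean : ∀ {q k} → ¬ Entry h q k
        clean = hybrid-clean arc a′ p≢p′
        enters : ∀ {u′ y} → ¬ h ⇝ u′ → h ≽ y → u′ ≽ y → u′ ⇝ w ⊎ u′ ⇝ p
        enters ¬hu hy uy with enter-clean clean ¬hu hy uy
        ... | _ , q , b with third-parent p≢p′ arc a′ b
        ...   | inj₁ refl = inj₂ q
        ...   | inj₂ refl = inj₁ q
      -- All four below `e′` would contradict the choice of `w` as lowest.
      analyse (_◅_ {j = e′} a r) = AtChild.impossible e′ (r ◅◅ (a′ ◅ ε)) enters
        (λ all → lowest a (r , all))
        where
        entry-e : Entry e′ p h
        entry-e = entry (λ ep → out (c⇝w ◅◅ (a ◅ ep))) (r ◅◅ (a′ ◅ ε))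
                    (λ { refl → no-cycle a′ r }) arc
        enters : ∀ {u′ y} → ¬ e′ ⇝ u′ → e′ ≽ y → u′ ≽ y → u′ ⇝ w ⊎ u′ ⇝ p
        enters ¬eu ey uy with enter-tree entry-e a ¬eu ey uy
        ... | inj₁ q = inj₁ q
        ... | inj₂ (q , _) = inj₂ q

    Result : Set
    Result = ∃[ X ] ∃[ Y ] (Glued (adj G) S X Y ⊎ Glued (co (adj G)) S X Y)

    glued-P4-free : NoP4 (adj G) S → Result
    glued-P4-free free = S , Subset.⊥ , inj₁ record
      { X⊆S = λ x → x ; Y⊆S = ⊥-elim ∘ ∉⊥ ; cover = inj₁ ; freeX = free
      ; freeY = λ i → ⊥-elim (∉⊥ i) ; meet = λ _ i → ⊥-elim (∉⊥ i)
      ; cross = λ _ _ i → ⊥-elim (∉⊥ i) }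

    module Lowest (u : Fin m) (u≽ : ∀ {x} → x ∈ S → u ≽ x)
                  (lowest : ∀ {c} → u ⟶ c → ∃[ z ] (z ∈ S × ¬ c ≽ z)) where

      -- When no child of `u` has two vertices of `S` below it, `u` is the least common ancestor of
      -- every pair, so `S` is complete or edgeless.
      star-uniform : (∀ {c x y} → u ⟶ c → x ∈ S → y ∈ S → x ≢ y → c ≽ x → ¬ c ≽ y) →
        NoP4 (adj G) S
      star-uniform scattered {a} {b} {c} sa sb sc _ P = clash
        (trans (sym (uniform sa sb (P4-a≢b (adj-sym G) P))) (P4.ab P))
        (trans (sym (uniform sa sc (P4-a≢c (adj-sym G) P))) (P4.ac P))
        where
        least : ∀ {x y} → x ∈ S → y ∈ S → x ≢ y → CommonAbove u x y
        least sx sy x≢y {u′} ux uy with reach? u u′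
        ... | yes ε = ε
        ... | yes (a ◅ r) = ⊥-elim (scattered a sx sy x≢y (r ◅◅ ux) (r ◅◅ uy))
        ... | no ¬uu with enter ¬uu (u≽ sx) ux | enter ¬uu (u≽ sy) uy
        ... | inj₁ (_ , q , a) | _ = q ◅◅ (a ◅ ε)
        ... | _ | inj₁ (_ , q , a) = q ◅◅ (a ◅ ε)
        -- Both paths use the unique entry of `u`, so `x` and `y` lie below `h` and hence below one
        -- child of `u`.
        ... | inj₂ (_ , _ , e , _ , hx) | inj₂ (_ , _ , e′ , _ , hy)
          with refl , refl ← entry-unique e e′ | Entry.below e
        ... | ε = ⊥-elim (Entry.strict e refl)
        ... | a ◅ r = ⊥-elim (scattered a sx sy x≢y (r ◅◅ hx) (r ◅◅ hy))
        uniform : ∀ {x y} → x ∈ S → y ∈ S → x ≢ y → adj G x y ≡ isOne (t u)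
        uniform sx sy x≢y = adj-least x≢y (u≽ sx) (u≽ sy) (least sx sy x≢y)

      -- The gall containing the arc u ⟶ c has u as its top: otherwise the descendants of c
      -- would form a module.
      top-of-gall : u ⟶ c → Entry c p h → y ∈ S → c ≽ y → y′ ∈ S → c ≽ y′ → y ≢ y′ → u ⇝ p
      top-of-gall {c} {p} {h} a e sy cy sy′ cy′ y≢y′ with reach? u p | lowest a
      ... | yes r | _ = r
      ... | no ¬up | z , z∈S , ¬cz = ⊥-elim (y≢y′ (prime-small-above (cluster? c) proj₁
              (λ (_ , cy) → a ◅ cy) above z∈S (¬cz ∘ proj₂) (sy , cy) (sy′ , cy′)))
        where
        entry-u : Entry u p h
        entry-u = entry ¬up (a ◅ Entry.below e) (λ { refl → no-cycle a (Entry.below e) }) (Entry.arc e)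
        above : ∀ {x y} → x ∈ S → ¬ (x ∈ S × c ≽ x) → y ∈ S × c ≽ y → CommonAbove u x y
        above {x} sx ¬x (_ , cy) {u′} ux uy
          with enter-tree e a (λ cu → ¬x (sx , cu ◅◅ ux)) cy uy
        ... | inj₁ q = q
        ... | inj₂ (q , _) with enter (λ uu → ¬up (uu ◅◅ q)) (u≽ sx) ux
        ...   | inj₁ (_ , r , b) = r ◅◅ (b ◅ ε)
        ...   | inj₂ (_ , _ , e′ , _ , hx) with refl , refl ← entry-unique entry-u e′ =
                ⊥-elim (¬x (sx , Entry.below e ◅◅ hx))

      -- The right-hand side of the gall may be the single arc u ⟶ h.
      module Gall {c p h p′ d : Fin m} (a : u ⟶ c) (e : Entry c p h)
                  (c⇝p′ : c ⇝ p′) (a′ : p′ ⟶ h) (b : u ⟶ d)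
                  (right : (d ≡ h × p ≡ u) ⊎ d ⇝ p)
                  {y₁ y₂ : Fin n} (s₁ : y₁ ∈ S) (c₁ : c ≽ y₁) (s₂ : y₂ ∈ S) (c₂ : c ≽ y₂)
                  (y₁≢y₂ : y₁ ≢ y₂) where

        open Entry e renaming (arc to arc-h)

        p≢p′ : p ≢ p′
        p≢p′ refl = outside c⇝p′

        d⇝h : d ⇝ h
        d⇝h = case right of λ where
          (inj₁ (refl , _)) → ε
          (inj₂ r) → r ◅◅ (arc-h ◅ ε)

        -- Seen from `d`, the two parents of `h` exchange roles. A path from `d` to `p′` would enter
        -- below `c` through `u` or through `h`, closing a directed cycle.
        entry-d : d ⇝ p → Entry d p′ h
        entry-d r = entry ¬dp′ d⇝h (λ { refl → no-cycle arc-h r }) a′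
          where
          ¬dp′ : ¬ d ⇝ p′
          ¬dp′ dp′ with enter-tree e a (λ cd → outside (cd ◅◅ r)) c⇝p′ dp′
          ... | inj₁ q = no-cycle b q
          ... | inj₂ (_ , hp′) = no-cycle a′ hp′

        via-c : ∀ {x y} → ¬ c ≽ x → c ≽ y → ¬ h ≽ y → CommonAbove u x y
        via-c ¬cx cy ¬hy {u′} ux uy with enter-tree e a (λ cu → ¬cx (cu ◅◅ ux)) cy uy
        ... | inj₁ q = q
        ... | inj₂ (_ , hy) = ⊥-elim (¬hy hy)

        via-d : ∀ {x y} → ¬ d ≽ x → d ≽ y → ¬ h ≽ y → CommonAbove u x y
        via-d ¬dx dy ¬hy ux uy = case right of λ where
          (inj₁ (refl , _)) → ⊥-elim (¬hy dy)
          (inj₂ r) → case enter-tree (entry-d r) b (λ du → ¬dx (du ◅◅ ux)) dy uy of λ where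
            (inj₁ q) → q
            (inj₂ (_ , hy)) → ⊥-elim (¬hy hy)

        -- An ancestor of `y` that gets below `c` by way of `p` must first get onto the right-hand
        -- side of the gall, which is possible only through `u`.
        via-h : ∀ {x y} → ¬ c ≽ x → ¬ d ≽ x → h ≽ y → CommonAbove u x y
        via-h ¬cx ¬dx hy {u′} ux uy with enter-tree e a (λ cu → ¬cx (cu ◅◅ ux)) (below ◅◅ hy) uy
        ... | inj₁ q = q
        ... | inj₂ (q , _) = case right of λ where
          (inj₁ (_ , refl)) → q
          (inj₂ r) → case enter-tree (entry-d r) b (λ du → ¬dx (du ◅◅ ux)) r q of λ where
            (inj₁ q′) → q′
            (inj₂ (_ , hp)) → ⊥-elim (no-cycle arc-h hp)

        -- When `d` is above `p`, it is not below `c`; its path to `y` passes through `u`, which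
        -- would close a cycle, or through `h`.
        both⇒h : ∀ {y} → c ≽ y → d ≽ y → h ≽ y
        both⇒h cy dy = case right of λ where
          (inj₁ (refl , _)) → dy
          (inj₂ r) → case enter-tree e a (λ cd → outside (cd ◅◅ r)) cy dy of λ where
            (inj₁ q) → ⊥-elim (no-cycle b q)
            (inj₂ (_ , hy)) → hy

        h-small : ∀ {y y′} → y ∈ S → h ≽ y → y′ ∈ S → h ≽ y′ → y ≡ y′
        h-small with lowest a
        ... | z , z∈S , ¬cz = clean-small (hybrid-clean arc-h a′ p≢p′) z∈S (¬cz ∘ (below ◅◅_))

        Spanned : Fin n → Set
        Spanned x = x ∈ S × (c ≽ x ⊎ d ≽ x)

        spanned? : ∀ x → Dec (Spanned x)
        spanned? x = (x ∈? S) ×-dec (≽? c x ⊎-dec ≽? d x)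

        spanned-above : ∀ {x y} → x ∈ S → ¬ Spanned x → Spanned y → CommonAbove u x y
        spanned-above {x} {y} sx ¬x (_ , cdy) with ≽? h y
        ... | yes hy = via-h (λ cx → ¬x (sx , inj₁ cx)) (λ dx → ¬x (sx , inj₂ dx)) hy
        ... | no ¬hy with cdy
        ...   | inj₁ cy = via-c (λ cx → ¬x (sx , inj₁ cx)) cy ¬hy
        ...   | inj₂ dy = via-d (λ dx → ¬x (sx , inj₂ dx)) dy ¬hy

        -- The vertices of `S` below `c` or `d` share with the rest of `S` only ancestors above `u`,
        -- so they form a module. It contains `y₁` and `y₂`, and primality leaves nothing outside.
        spans : ∀ {x} → x ∈ S → c ≽ x ⊎ d ≽ x
        spans {x} sx with ≽? c x ⊎-dec ≽? d x
        ... | yes r = r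
        ... | no ¬r = ⊥-elim (y₁≢y₂ (prime-small-above spanned? proj₁ (λ (s , _) → u≽ s)
                spanned-above sx (¬r ∘ proj₂) (s₁ , inj₁ c₁) (s₂ , inj₁ c₂)))

        X Y : Subset n
        X = subset (cluster? c)
        Y = subset (cluster? d)

        toX : ∀ {x} → x ∈ S → c ≽ x → x ∈ X
        toX s r = ∈-subset⁺ (cluster? c) (s , r)

        toY : ∀ {x} → x ∈ S → d ≽ x → x ∈ Y
        toY s r = ∈-subset⁺ (cluster? d) (s , r)

        X⁻ : ∀ {x} → x ∈ X → x ∈ S × c ≽ x
        X⁻ = ∈-subset⁻ (cluster? c)

        Y⁻ : ∀ {x} → x ∈ Y → x ∈ S × d ≽ x
        Y⁻ = ∈-subset⁻ (cluster? d)

        free-X : NoP4 (adj G) X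
        free-X with lowest a
        ... | z , z∈S , ¬cz = noP4-below e c⇝p′ a′ z∈S ¬cz

        free-Y : NoP4 (adj G) Y
        free-Y i j k l P = case right of λ where
          (inj₁ (refl , _)) → P4-a≢b (adj-sym G) P
            (h-small (proj₁ (Y⁻ i)) (proj₂ (Y⁻ i)) (proj₁ (Y⁻ j)) (proj₂ (Y⁻ j)))
          (inj₂ r) → let (z , z∈S , ¬dz) = lowest b in
            noP4-below (entry-d r) r arc-h z∈S ¬dz i j k l P

        meets : ∀ {x y} → x ∈ X → x ∈ Y → y ∈ X → y ∈ Y → x ≡ y
        meets xX xY yX yY = h-small (proj₁ (X⁻ xX)) (both⇒h (proj₂ (X⁻ xX)) (proj₂ (Y⁻ xY)))
                                    (proj₁ (X⁻ yX)) (both⇒h (proj₂ (X⁻ yX)) (proj₂ (Y⁻ yY)))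

        crossing : ∀ {x y} → x ∈ X → x ∉ Y → y ∈ Y → y ∉ X → adj G x y ≡ isOne (t u)
        crossing {x} {y} xX xY yY yX with X⁻ xX | Y⁻ yY
        ... | sx , cx | sy , dy = trans (adj-sym G x y)
          (adj-least (λ { refl → yX xX }) (u≽ sy) (u≽ sx)
            (via-c (yX ∘ toX sy) cx (λ hx → xY (toY sx (d⇝h ◅◅ hx)))))

        covers : ∀ {x} → x ∈ S → x ∈ X ⊎ x ∈ Y
        covers sx with spans sx
        ... | inj₁ r = inj₁ (toX sx r)
        ... | inj₂ r = inj₂ (toY sx r)

        glued : Result
        glued with isOne (t u) in tu
        ... | false = X , Y , inj₁ record
          { X⊆S = proj₁ ∘ X⁻ ; Y⊆S = proj₁ ∘ Y⁻ ; cover = covers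
          ; freeX = free-X ; freeY = free-Y ; meet = meets
          ; cross = λ p q r s → trans (crossing p q r s) tu }
        ... | true = X , Y , inj₂ record
          { X⊆S = proj₁ ∘ X⁻ ; Y⊆S = proj₁ ∘ Y⁻ ; cover = covers
          -- A P4 a, b, c, d of the complement is a P4 b, d, a, c of the graph, hence the permuted
          -- memberships.
          ; freeX = λ i j k l → free-X j l i k ∘ P4-co⁻ (adj-sym G)
          ; freeY = λ i j k l → free-Y j l i k ∘ P4-co⁻ (adj-sym G)
          ; meet = meets
          ; cross = λ p q r s → cong not (trans (crossing p q r s) tu) }

      -- If no child of `u` is above two vertices of `S`, then `S` is P4-free. Otherwise such a
      -- child `c` has an entry, for else its cluster would be a module, and the gall of that entry
      -- has top `u`.
      result : Result
      result with any? (λ c → any? λ x → any? λ y → arc? u c ×-dec (x ∈? S) ×-dec (y ∈? S) ×-dec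
                         ¬? (x ≟ y) ×-dec ≽? c x ×-dec ≽? c y)
      ... | no none = glued-P4-free (star-uniform λ a sx sy ne cx cy →
              none (_ , _ , _ , a , sx , sy , ne , cx , cy))
      ... | yes (c , x , y , a , sx , sy , x≢y , cx , cy)
        with any? (λ p → any? λ h → entry? c p h) | lowest a
      ... | no none | z , z∈S , ¬cz =
            ⊥-elim (x≢y (clean-small (λ e → none (_ , _ , e)) z∈S ¬cz sx cx sy cy))
      ... | yes (p , h , e) | _ with other-parent e | top-of-gall a e sx cx sy cy x≢y
      ... | p′ , c⇝p′ , a′ | ε =
            Gall.glued a e c⇝p′ a′ (Entry.arc e) (inj₁ (refl , refl)) sx cx sy cy x≢y
      ... | p′ , c⇝p′ , a′ | b ◅ r =
            Gall.glued a e c⇝p′ a′ b (inj₂ r) sx cx sy cy x≢y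

  primeGlued : PrimeGlued G
  primeGlued S prime
    with descend {w = root} {P = λ w → ∀ x → x ∈ S → w ≽ x}
           (λ w → all? λ x → (x ∈? S) →-dec ≽? w x) (λ x _ → root⇝ (ℓ x))
  ... | u , _ , u≽ , lowest = Lowest.result prime u (u≽ _) missed
    where
    missed : ∀ {c} → u ⟶ c → ∃[ z ] (z ∈ S × ¬ c ≽ z)
    missed {c} a with any? (λ z → (z ∈? S) ×-dec ¬? (≽? c z))
    ... | yes r = r
    ... | no none = ⊥-elim (lowest a all)
      where
      all : ∀ x → x ∈ S → c ≽ x
      all x sx with ≽? c x
      ... | yes r = r
      ... | no ¬r = ⊥-elim (none (x , sx , ¬r))

-- Conclusion for GaTEx graphs

nonTrivial-primeGlued : ∀ {n} {G : Graph n} (W : GaTExWitness G) → let open GaTExWitness W in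
  Acyclic A → NonTrivialGalledTree A ℓ → PrimeGlued G
nonTrivial-primeGlued {G = G} W acyclic N =
  Explained.primeGlued A acyclic root (Reach.source-reaches A acyclic root parent)
    indeg≤2 galled G ℓ t explains
  where
  open GaTExWitness W
  open NonTrivialGalledTree N

  parent : ∀ v → v ≢ root → ∃[ p ] Arc A p v
  parent v v≢root with any? (λ p → Reach.arc? A acyclic p v)
  ... | yes r = r
  ... | no none = ⊥-elim (v≢root (root-unique v (count≡0 _ noArc)))
    where
    noArc : ∀ p → A p v ≡ false
    noArc p with A p v in e
    ... | true = ⊥-elim (none (p , e))
    ... | false = refl

  indeg≤2 : ∀ v → indeg A v ≤ 2
  indeg≤2 v with v ≟ root | any? (λ x → ℓ x ≟ v)
  ... | yes refl | _ = subst (_≤ 2) (sym root-indeg) z≤n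
  ... | no _ | yes leaf = subst (_≤ 2) (sym (proj₂ (Equivalence.to (leaves v) leaf))) (s≤s z≤n)
  ... | no v≢root | no ¬leaf with inner v v≢root ¬leaf
  ...   | inj₁ (e , _) = subst (_≤ 2) (sym e) (s≤s z≤n)
  ...   | inj₂ (e , _) = ℕ.≤-reflexive e

singleton-primeGlued : ∀ {n} (G : Graph n) → n ≡ 1 → PrimeGlued G
singleton-primeGlued G refl S _ = S , Subset.⊥ , inj₁ record
  { X⊆S = λ x → x ; Y⊆S = ⊥-elim ∘ ∉⊥ ; cover = inj₁
  ; freeX = λ {a} {b} _ _ _ _ P → P4-a≢b (adj-sym G) P (only a b)
  ; freeY = λ i → ⊥-elim (∉⊥ i) ; meet = λ _ i → ⊥-elim (∉⊥ i)
  ; cross = λ _ _ i → ⊥-elim (∉⊥ i) }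
  where
  only : (a b : Fin 1) → a ≡ b
  only zero zero = refl

gatex-primeGlued : ∀ {n} {G : Graph n} → IsGaTEx G → PrimeGlued G
gatex-primeGlued {G = G} W with GaTExWitness.galledTree W
... | _ , inj₁ (n≡1 , _) = singleton-primeGlued G n≡1
... | acyclic , inj₂ N = nonTrivial-primeGlued W acyclic N

mainTheorem15 : ∀ {n} (G : Graph n) → IsGaTEx G → ¬ HasInducedHouse G →
    Meyniel G × VeryStronglyPerfect G × Brittle G
mainTheorem15 G gatex noHouse = meyniel G el , veryStronglyPerfect G el , brittle G el
  where
  el : ∀ S → Elim (adj G) S
  el = elim G noHouse (gatex-primeGlued gatex)
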